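{- For any integer $k\ge 3$, $\mathrm{ar}^*(n,O_{2k})=(1+o(1))\binom{n}{\lfloor n/2\rfloor}$ as $n\to\infty$.
   Context: $[n]=\{1,\dots,n\}$, $2^{[n]}$ its power set. A family $\mathcal{G}$ of sets is a strong copy of a poset $(P,\leqslant)$ if there is a bijection $f:P\to\mathcal{G}$ with $p\leqslant q\iff f(p)\subseteq f(q)$. $\mathrm{ar}^*(n,P)$ is the maximum number of colors used in a coloring of $2^{[n]}$ that admits no strong copy of $P$ whose sets all receive distinct colors. The crown poset $O_{2k}$ has elements $a_1,\dots,a_k,b_1,\dots,b_k$ whose only relations are $a_i<b_i$, $a_{i+1}<b_i$ for $i=1,\dots,k-1$, and $a_k<b_k$, $a_1<b_k$. -}

module Defs where

open import Data.Nat using (ℕ; zero; suc; _+_; _*_; _≤_; _/_; ∣_-_∣)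
open import Data.Nat.Combinatorics using (_C_)
open import Data.Fin using (Fin; toℕ)
open import Data.Fin.Subset using (Subset; _⊆_)
open import Data.Sum using (_⊎_; inj₁; inj₂)
open import Data.Product using (_×_; Σ; ∃; _,_)
open import Relation.Binary.PropositionalEquality using (_≡_)
open import Function.Bundles using (_⇔_)

-- A poset is given by a carrier P and its (reflexive) order relation _≼_.

IsStrongCopy : (n : ℕ) {P : Set} (_≼_ : P → P → Set) → (P → Subset n) → Set
IsStrongCopy n {P} _≼_ f =
  (∀ p q → f p ≡ f q → p ≡ q) × (∀ p q → (p ≼ q) ⇔ (f p ⊆ f q))

IsRainbow : (n m : ℕ) {P : Set} → (Subset n → Fin m) → (P → Subset n) → Set
IsRainbow n m c f = ∀ p q → c (f p) ≡ c (f q) → p ≡ q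

UsesExactly : (n m : ℕ) → (Subset n → Fin m) → Set
UsesExactly n m c = ∀ (y : Fin m) → ∃ λ (A : Subset n) → c A ≡ y

NoRainbowCopy : (n m : ℕ) {P : Set} (_≼_ : P → P → Set) → (Subset n → Fin m) → Set
NoRainbowCopy n m _≼_ c =
  ∀ f → IsStrongCopy n _≼_ f → IsRainbow n m c f → Data.Empty.⊥
  where import Data.Empty

IsArStar : (n : ℕ) {P : Set} (_≼_ : P → P → Set) → ℕ → Set
IsArStar n _≼_ m =
  (Σ (Subset n → Fin m) λ c → UsesExactly n m c × NoRainbowCopy n m _≼_ c)
  × (∀ m' (c : Subset n → Fin m') → UsesExactly n m' c →
       NoRainbowCopy n m' _≼_ c → m' ≤ m)

-- The crown O_{2k}: elements a_i = inj₁ i, b_i = inj₂ i (i : Fin k, 0-based).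
-- Strict relations: a_i < b_i, a_{i+1} < b_i, and a_0 < b_{k-1}.
data CrownLe (k : ℕ) : Fin k ⊎ Fin k → Fin k ⊎ Fin k → Set where
  crown-refl : ∀ x → CrownLe k x x
  crown-same : ∀ i → CrownLe k (inj₁ i) (inj₂ i)
  crown-next : ∀ i j → suc (toℕ i) ≡ toℕ j → CrownLe k (inj₁ j) (inj₂ i)
  crown-wrap : ∀ i j → suc (toℕ i) ≡ k → toℕ j ≡ 0 → CrownLe k (inj₁ j) (inj₂ i)

{-# OPTIONS --safe #-}
-- Lower bound: the middle level gets pairwise distinct colours and everything else one further
-- colour; of the two disjoint comparable pairs a₁ < b₁, a₂ < b₂ each needs an element off the
-- middle level.  The maximum exists by exhaustive search.
--
-- Upper bound: one set X of each colour is chosen, dropping the few colours used far from the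
-- middle level.  The chosen family F still has more than (1 + ε) times the size of the middle
-- level, so a random maximal chain meets it more than once on average, and from many members of
-- F a random chain meets F again with probability bounded below.  The singleton {v} lies far
-- from the middle and so has a colour not used by F; it serves as one of the lower elements of
-- the crown.  It remains to find in F a walk b₀ ⊇ a₀ ⊆ b₁ ⊇ a₁ ⊆ … ⊇ a_r ⊆ b_{r+1} without
-- further inclusions in which v belongs to the two extreme b's only.  For a suitable v, found
-- by averaging, many members of F avoid v and have a positive proportion of the chains above
-- them that first add v and later meet F; pruning members with poor continuations r times
-- leaves a place to start the walk.  Unwanted inclusions are prevented by elements gained and
-- lost on the way; these are respected since a random chain rarely adds any given element
-- within the narrow band of levels that carries F.
--
-- All probabilities are scaled to integers: a chain from X to the top has weight 1, so there are
-- |∁ X| ! of them.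

module Submission where

open import Defs
import Algebra.Properties.CommutativeMonoid.Sum
open import Data.Bool.Base using (Bool; true; false; if_then_else_; _∧_; _∨_; not)
import Data.Bool.Properties as Bool
open import Data.Empty using (⊥-elim)
open import Data.Fin using (Fin; zero; suc; toℕ; fromℕ; fromℕ<; inject₁; _↑ˡ_; _↑ʳ_; splitAt)
import Data.Fin.Properties as Fin
open import Data.Fin.Properties using (any?; all?; splitAt-↑ˡ; splitAt-↑ʳ; toℕ-injective; toℕ-fromℕ; toℕ-fromℕ<; toℕ-inject₁; toℕ<n; toℕ≤pred[n])
open import Data.Fin.Subset using (Subset; inside; outside; _⊆_; _∈_; ∁; ∣_∣; ⊥; ⁅_⁆)
open import Data.Fin.Subset.Properties using (drop-∷-⊆; out⊆; s⊆s; _⊆?_; anySubset?; ⊆-refl; ⊆-reflexive; ⊆-trans; ⊆-antisym; p⊆q⇒∣p∣≤∣q∣; p⊂q⇒∣p∣<∣q∣; p⊆q⇒∁p⊇∁q; ∣⊥∣≡0; ∣⁅x⁆∣≡1; x∈⁅x⁆; x∈⁅y⁆⇒x≡y)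
open import Data.List.Base using (List; []; _∷_; length; foldr)
open import Data.List.Relation.Unary.All using (All; []; _∷_)
import Data.List.Relation.Unary.All as All
open import Data.Nat
open import Data.Nat.Combinatorics using (_C_; nCn≡1; nCk≡nC[n∸k]; nCk+nC[k+1]≡[n+1]C[k+1]; k![n∸k]!∣n!; nCk≡n!/k![n-k]!; k>n⇒nCk≡0)
open import Data.Nat.DivMod using (m/n*n≡m; m/n≤m; m/n*n≤m; m*n/n≡m; /-monoˡ-≤; m≥n⇒m/n>0; m≡m%n+[m/n]*n; m%n<n)
open import Data.Nat.Properties
open import Data.Nat.Tactic.RingSolver using (solve-∀)
open import Data.Product using (_×_; ∃; _,_; proj₁; proj₂)
open import Data.Sum using (_⊎_; inj₁; inj₂; [_,_])
import Data.Sum.Properties as Sum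
open import Data.Vec using (Vec; []; _∷_; lookup; _[_]≔_)
open import Data.Vec.Properties using (≡-dec; lookup-map; lookup∘updateAt; lookup∘updateAt′; []=⇒lookup; lookup⇒[]=)
open import Function using (_∘_; id)
open import Function.Bundles using (Equivalence; _⇔_; mk⇔)
open import Relation.Binary using (tri<; tri≈; tri>)
open import Relation.Binary.PropositionalEquality hiding ([_])
open import Relation.Nullary using (¬_; Dec; yes; no; does; contradiction; ¬?; _×-dec_; _→-dec_; _⊎-dec_)
open import Relation.Nullary.Decidable using (map′; dec-true; dec-false)
open Algebra.Properties.CommutativeMonoid.Sum +-0-commutativeMonoid using (sum; sum-cong-≗; ∑-distrib-+)

private variable
  n : ℕ

-- Complements in the power set

∁-involutive : (X : Subset n) → ∁ (∁ X) ≡ X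
∁-involutive []            = refl
∁-involutive (inside  ∷ X) = cong (inside ∷_) (∁-involutive X)
∁-involutive (outside ∷ X) = cong (outside ∷_) (∁-involutive X)

∣X∣+∣∁X∣ : (X : Subset n) → ∣ X ∣ + ∣ ∁ X ∣ ≡ n
∣X∣+∣∁X∣ []            = refl
∣X∣+∣∁X∣ (inside  ∷ X) = cong suc (∣X∣+∣∁X∣ X)
∣X∣+∣∁X∣ (outside ∷ X) = trans (+-suc _ _) (cong suc (∣X∣+∣∁X∣ X))

-- Sums over the power set

ΣS : (Subset n → ℕ) → ℕ
ΣS {zero}  f = f []
ΣS {suc n} f = ΣS (f ∘ (outside ∷_)) + ΣS (f ∘ (inside ∷_))

ΣS-mono : {f g : Subset n → ℕ} → (∀ X → f X ≤ g X) → ΣS f ≤ ΣS g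
ΣS-mono {zero}  f≤g = f≤g []
ΣS-mono {suc n} f≤g = +-mono-≤ (ΣS-mono (f≤g ∘ (outside ∷_))) (ΣS-mono (f≤g ∘ (inside ∷_)))

ΣS-cong : {f g : Subset n → ℕ} → (∀ X → f X ≡ g X) → ΣS f ≡ ΣS g
ΣS-cong f≡g = ≤-antisym (ΣS-mono (≤-reflexive ∘ f≡g)) (ΣS-mono (≤-reflexive ∘ sym ∘ f≡g))

interchange : ∀ a b c d → (a + b) + (c + d) ≡ (a + c) + (b + d)
interchange = solve-∀

ΣS-+ : (f g : Subset n → ℕ) → ΣS (λ X → f X + g X) ≡ ΣS f + ΣS g
ΣS-+ {zero}  f g = refl
ΣS-+ {suc n} f g = trans
  (cong₂ _+_ (ΣS-+ (f ∘ (outside ∷_)) (g ∘ (outside ∷_))) (ΣS-+ (f ∘ (inside ∷_)) (g ∘ (inside ∷_))))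
  (interchange (ΣS (f ∘ (outside ∷_))) (ΣS (g ∘ (outside ∷_))) _ _)

ΣS-* : ∀ c (f : Subset n → ℕ) → ΣS (λ X → c * f X) ≡ c * ΣS f
ΣS-* {zero}  c f = refl
ΣS-* {suc n} c f = trans (cong₂ _+_ (ΣS-* c (f ∘ (outside ∷_))) (ΣS-* c (f ∘ (inside ∷_))))
                         (sym (*-distribˡ-+ c (ΣS (f ∘ (outside ∷_))) _))

ΣS-∁ : (f : Subset n → ℕ) → ΣS (f ∘ ∁) ≡ ΣS f
ΣS-∁ {zero}  f = refl
ΣS-∁ {suc n} f = trans (cong₂ _+_ (ΣS-∁ (f ∘ (inside ∷_))) (ΣS-∁ (f ∘ (outside ∷_))))
                         (+-comm (ΣS (f ∘ (inside ∷_))) _)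

ΣS-≥ : (f : Subset n → ℕ) (X : Subset n) → f X ≤ ΣS f
ΣS-≥ f []            = ≤-refl
ΣS-≥ f (inside  ∷ X) = ≤-trans (ΣS-≥ _ X) (m≤n+m _ _)
ΣS-≥ f (outside ∷ X) = ≤-trans (ΣS-≥ _ X) (m≤m+n _ _)

0<m+n : ∀ m {n} → 0 < m + n → 0 < m ⊎ 0 < n
0<m+n zero    p = inj₂ p
0<m+n (suc m) p = inj₁ z<s

ΣS-pos : (f : Subset n → ℕ) → 0 < ΣS f → ∃ λ X → 0 < f X
ΣS-pos {zero}  f p = [] , p
ΣS-pos {suc n} f p with 0<m+n (ΣS (f ∘ (outside ∷_))) p
... | inj₁ q = let X , r = ΣS-pos _ q in outside ∷ X , r
... | inj₂ q = let X , r = ΣS-pos _ q in inside ∷ X , r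

-- The covering relation

infix 4 _⋖_
data _⋖_ : Subset n → Subset n → Set where
  here  : {X : Subset n} → outside ∷ X ⋖ inside ∷ X
  there : ∀ {s} {X Y : Subset n} → X ⋖ Y → s ∷ X ⋖ s ∷ Y

⋖⇒⊆ : {X Y : Subset n} → X ⋖ Y → X ⊆ Y
⋖⇒⊆ here      = out⊆ ⊆-refl
⋖⇒⊆ (there c) = s⊆s (⋖⇒⊆ c)

⋖⇒∣∁∣ : {X Y : Subset n} → X ⋖ Y → ∣ ∁ X ∣ ≡ suc ∣ ∁ Y ∣
⋖⇒∣∁∣ here                  = refl
⋖⇒∣∁∣ (there {s = inside}  c) = ⋖⇒∣∁∣ c
⋖⇒∣∁∣ (there {s = outside} c) = cong suc (⋖⇒∣∁∣ c)

-- Summation over the upper covers of `X`, each of which adds one element; iterated, it runs through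
-- the chains above `X`.
up : (Subset n → ℕ) → Subset n → ℕ
up f []            = 0
up f (inside  ∷ X) = up (f ∘ (inside ∷_)) X
up f (outside ∷ X) = f (inside ∷ X) + up (f ∘ (outside ∷_)) X

up-mono : {f g : Subset n → ℕ} (X : Subset n) → (∀ Y → X ⋖ Y → f Y ≤ g Y) → up f X ≤ up g X
up-mono []            f≤g = z≤n
up-mono (inside  ∷ X) f≤g = up-mono X (λ Y c → f≤g _ (there c))
up-mono (outside ∷ X) f≤g = +-mono-≤ (f≤g _ here) (up-mono X (λ Y c → f≤g _ (there c)))

up-cong : {f g : Subset n → ℕ} (X : Subset n) → (∀ Y → X ⋖ Y → f Y ≡ g Y) → up f X ≡ up g X
up-cong X f≡g = ≤-antisym (up-mono X (λ Y c → ≤-reflexive (f≡g Y c)))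
                          (up-mono X (λ Y c → ≤-reflexive (sym (f≡g Y c))))

up-+ : (f g : Subset n → ℕ) (X : Subset n) → up (λ Y → f Y + g Y) X ≡ up f X + up g X
up-+ f g []            = refl
up-+ f g (inside  ∷ X) = up-+ _ _ X
up-+ f g (outside ∷ X) = trans
  (cong (f (inside ∷ X) + g (inside ∷ X) +_) (up-+ (f ∘ (outside ∷_)) (g ∘ (outside ∷_)) X))
  (interchange (f (inside ∷ X)) (g (inside ∷ X)) _ _)

up-const : ∀ c (X : Subset n) → up (λ _ → c) X ≡ ∣ ∁ X ∣ * c
up-const c []            = refl
up-const c (inside  ∷ X) = up-const c X
up-const c (outside ∷ X) = cong (c +_) (up-const c X)

up-pos : (f : Subset n → ℕ) (X : Subset n) → 0 < up f X → ∃ λ Y → X ⋖ Y × 0 < f Y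
up-pos f (inside  ∷ X) p = let Y , c , q = up-pos _ X p in _ , there c , q
up-pos f (outside ∷ X) p with 0<m+n (f (inside ∷ X)) p
... | inj₁ q = _ , here , q
... | inj₂ q = let Y , c , r = up-pos _ X q in _ , there c , r

-- The covers of X inside Z number |Z| − |X|.
up-within : ∀ c (f : Subset n → ℕ) {X Z : Subset n} → X ⊆ Z →
            (∀ Y → X ⋖ Y → f Y ≤ c) → (∀ Y → X ⋖ Y → ¬ Y ⊆ Z → f Y ≡ 0) →
            up f X ≤ (∣ ∁ X ∣ ∸ ∣ ∁ Z ∣) * c
up-within c f {[]}          {[]}          X⊆Z b z = z≤n
up-within c f {inside  ∷ X} {inside  ∷ Z} X⊆Z b z =
  up-within c _ (drop-∷-⊆ X⊆Z) (λ Y k → b _ (there k)) (λ Y k Y⊈Z → z _ (there k) (Y⊈Z ∘ drop-∷-⊆))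
up-within c f {inside  ∷ X} {outside ∷ Z} X⊆Z b z = contradiction (X⊆Z Data.Vec.here) λ ()
up-within c f {outside ∷ X} {inside  ∷ Z} X⊆Z b z = begin
  f (inside ∷ X) + up _ X            ≤⟨ +-mono-≤ (b _ here) ih ⟩
  c + (∣ ∁ X ∣ ∸ ∣ ∁ Z ∣) * c        ≡⟨ cong (_* c) (sym (+-∸-assoc 1 ∣∁Z∣≤∣∁X∣)) ⟩
  (suc ∣ ∁ X ∣ ∸ ∣ ∁ Z ∣) * c        ∎
  where
  open ≤-Reasoning
  ih = up-within c _ (drop-∷-⊆ X⊆Z) (λ Y k → b _ (there k))
         (λ Y k Y⊈Z → z _ (there k) (Y⊈Z ∘ drop-∷-⊆))
  ∣∁Z∣≤∣∁X∣ : ∣ ∁ Z ∣ ≤ ∣ ∁ X ∣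
  ∣∁Z∣≤∣∁X∣ = +-cancelˡ-≤ ∣ X ∣ _ _ (≤-trans (+-monoˡ-≤ _ (p⊆q⇒∣p∣≤∣q∣ (drop-∷-⊆ X⊆Z)))
    (≤-reflexive (trans (∣X∣+∣∁X∣ Z) (sym (∣X∣+∣∁X∣ X)))))
up-within c f {outside ∷ X} {outside ∷ Z} X⊆Z b z =
  -- The cover that adds the head is not inside `Z`, so its term vanishes.
  subst (λ w → w + up (f ∘ (outside ∷_)) X ≤ (∣ ∁ X ∣ ∸ ∣ ∁ Z ∣) * c) (sym (z _ here λ s → contradiction (s Data.Vec.here) λ ()))
  (up-within c _ (drop-∷-⊆ X⊆Z) (λ Y k → b _ (there k)) (λ Y k Y⊈Z → z _ (there k) (Y⊈Z ∘ drop-∷-⊆)))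

-- Exactly one cover of X contains a given t ∉ X.
up-through : ∀ c c′ (f : Subset n → ℕ) (X : Subset n) (t : Fin n) → lookup X t ≡ outside →
             (∀ Y → X ⋖ Y → lookup Y t ≡ inside → f Y ≤ c) →
             (∀ Y → X ⋖ Y → lookup Y t ≡ outside → f Y ≤ c′) →
             up f X ≤ c + pred ∣ ∁ X ∣ * c′
up-through c c′ f (outside ∷ X) zero    t∉X b b′ =
  +-mono-≤ (b _ here refl)
    (≤-trans (up-mono X (λ Y k → b′ _ (there k) refl)) (≤-reflexive (up-const c′ X)))
up-through c c′ f (inside  ∷ X) (suc t) t∉X b b′ =
  up-through c c′ _ X t t∉X (λ Y k → b _ (there k)) (λ Y k → b′ _ (there k))
up-through c c′ f (outside ∷ X) (suc t) t∉X b b′ = begin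
  f (inside ∷ X) + up _ X              ≤⟨ +-mono-≤ (b′ _ here t∉X) ih ⟩
  c′ + (c + pred ∣ ∁ X ∣ * c′)         ≡⟨ swap c′ c (pred ∣ ∁ X ∣) ⟩
  c + suc (pred ∣ ∁ X ∣) * c′          ≡⟨ cong (λ w → c + w * c′) (suc-pred _ {{≢-nonZero (nonempty X t t∉X)}}) ⟩
  c + ∣ ∁ X ∣ * c′                     ∎
  where
  open ≤-Reasoning
  ih = up-through c c′ _ X t t∉X (λ Y k → b _ (there k)) (λ Y k → b′ _ (there k))
  swap : ∀ x y z → x + (y + z * x) ≡ y + (1 + z) * x
  swap = solve-∀
  nonempty : ∀ {m} (X : Subset m) t → lookup X t ≡ outside → ∣ ∁ X ∣ ≢ 0
  nonempty (outside ∷ X) zero    e ()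
  nonempty (inside  ∷ X) (suc t) e p  = nonempty X t e p
  nonempty (outside ∷ X) (suc t) e ()

-- Families of sets and chains stopped at them

Family : ℕ → Set
Family n = Subset n → Bool

infix 4 _⊑_
_⊑_ : Family n → Family n → Set
S ⊑ T = ∀ X → S X ≡ true → T X ≡ true

∧-true : ∀ {x y} → x ∧ y ≡ true → x ≡ true × y ≡ true
∧-true {true} {true} refl = refl , refl

-- For X ∈ T these are the numbers of maximal chains from X to the top, resp. from the bottom to X.

pay charge : Family n → Subset n → ℕ
pay    T X = if T X then ∣ ∁ X ∣ ! else 0
charge T X = if T X then ∣ X ∣ ! else 0

pay-∁ : (T : Family n) (X : Subset n) → pay (T ∘ ∁) (∁ X) ≡ charge T X
pay-∁ T X rewrite ∁-involutive X = refl

charge-∁ : (T : Family n) (X : Subset n) → charge (T ∘ ∁) (∁ X) ≡ pay T X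
charge-∁ T X rewrite ∁-involutive X = refl

pay≤ : (T : Family n) (X : Subset n) → pay T X ≤ ∣ ∁ X ∣ !
pay≤ T X with T X
... | true  = ≤-refl
... | false = z≤n

pay-support : (T : Family n) (X : Subset n) → 0 < pay T X → T X ≡ true
pay-support T X p with T X
... | true = refl

pay-mono : {S T : Family n} → S ⊑ T → ∀ X → pay S X ≤ pay T X
pay-mono {S = S} {T} S⊑T X with S X | T X | S⊑T X
... | false | _     | _ = z≤n
... | true  | true  | _ = ≤-refl
... | true  | false | f = contradiction (f refl) λ ()

pay-split : (T P : Family n) (X : Subset n) →
            pay T X ≡ pay (λ Y → T Y ∧ P Y) X + pay (λ Y → T Y ∧ not (P Y)) X
pay-split T P X with T X | P X
... | false | _     = refl
... | true  | true  = sym (+-identityʳ _)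
... | true  | false = refl

-- hit Φ p j X follows a chain upwards from X until it meets Φ, for at most j steps,
-- and counts every chain with the value of p at that point.

hit : Family n → (Subset n → ℕ) → ℕ → Subset n → ℕ
hit Φ p zero    X = 0
hit Φ p (suc j) X = if Φ X then p X else up (hit Φ p j) X

module _ (Φ : Family n) where

  hit-mono : {p q : Subset n → ℕ} → (∀ X → Φ X ≡ true → p X ≤ q X) → ∀ j X → hit Φ p j X ≤ hit Φ q j X
  hit-mono p≤q zero    X = z≤n
  hit-mono p≤q (suc j) X with Φ X in eq
  ... | true  = p≤q X eq
  ... | false = up-mono X (λ Y _ → hit-mono p≤q j Y)

  hit-cong : {p q : Subset n → ℕ} → (∀ X → p X ≡ q X) → ∀ j X → hit Φ p j X ≡ hit Φ q j X
  hit-cong p≡q j X = ≤-antisym (hit-mono (λ Y _ → ≤-reflexive (p≡q Y)) j X)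
                                 (hit-mono (λ Y _ → ≤-reflexive (sym (p≡q Y))) j X)

  hit-+ : (p q : Subset n → ℕ) → ∀ j X → hit Φ (λ Y → p Y + q Y) j X ≡ hit Φ p j X + hit Φ q j X
  hit-+ p q zero    X = refl
  hit-+ p q (suc j) X with Φ X
  ... | true  = refl
  ... | false = trans (up-cong X (λ Y _ → hit-+ p q j Y)) (up-+ _ _ X)

  -- A chain from `X` has at most `∣ ∁ X ∣ + 1` members, so a larger step bound changes nothing.
  hit-stable : ∀ p j X → ∣ ∁ X ∣ < j → hit Φ p j X ≡ hit Φ p (suc j) X
  hit-stable p (suc j) X lt with Φ X
  ... | true  = refl
  ... | false = up-cong X (λ Y k → hit-stable p j Y (≤-trans (≤-reflexive (sym (⋖⇒∣∁∣ k))) (≤-pred lt)))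

  hit-pos : ∀ p j X → 0 < hit Φ p j X → ∃ λ Y → X ⊆ Y × 0 < p Y
  hit-pos p (suc j) X lt with Φ X
  ... | true  = X , ⊆-refl , lt
  ... | false = let Y , k , lt′ = up-pos _ X lt
                    Z , Y⊆Z , q = hit-pos p j Y lt′
                in Z , ⊆-trans (⋖⇒⊆ k) Y⊆Z , q

  hit-zero : ∀ p j X → (∀ Y → X ⊆ Y → p Y ≡ 0) → hit Φ p j X ≡ 0
  hit-zero p j X z with hit Φ p j X in eq
  ... | zero  = refl
  ... | suc _ = let Y , X⊆Y , q = hit-pos p j X (subst (0 <_) (sym eq) z<s)
                in contradiction (z Y X⊆Y) (m<n⇒n≢0 q)

-- Strict only at `d = 0`, which is the case of the full set and its lack of covers.
pred-! : ∀ d → d * pred d ! ≤ d !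
pred-! zero    = z≤n
pred-! (suc d) = ≤-refl

cover-! : {X Y : Subset n} → X ⋖ Y → ∣ ∁ Y ∣ ! ≡ pred ∣ ∁ X ∣ !
cover-! k = cong (λ d → pred d !) (sym (⋖⇒∣∁∣ k))

up-! : (X : Subset n) → up (λ Y → ∣ ∁ Y ∣ !) X ≤ ∣ ∁ X ∣ !
up-! X = ≤-trans (up-mono X (λ Y k → ≤-reflexive (cover-! k)))
  (≤-trans (≤-reflexive (up-const (pred ∣ ∁ X ∣ !) X)) (pred-! ∣ ∁ X ∣))

module _ (Φ : Family n) where

  -- The chains from `X` are shared out among its covers by `up-!`, so a payoff of at most one per
  -- chain stays so at every step.
  hit-≤ : ∀ p → (∀ X → p X ≤ ∣ ∁ X ∣ !) → ∀ j X → hit Φ p j X ≤ ∣ ∁ X ∣ !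
  hit-≤ p p≤ zero    X = z≤n
  hit-≤ p p≤ (suc j) X with Φ X
  ... | true  = p≤ X
  ... | false = ≤-trans (up-mono X (λ Y _ → hit-≤ p p≤ j Y)) (up-! X)

  -- With the full set in `Φ` every chain stops, and no chain is lost. The full set is excluded as a
  -- starting point since it has no cover.
  up-hit-total : (∀ X → ∣ ∁ X ∣ ≡ 0 → Φ X ≡ true) → ∀ j X → ∣ ∁ X ∣ ≤ j → ∣ ∁ X ∣ ≢ 0 →
                 up (hit Φ (λ Y → ∣ ∁ Y ∣ !) j) X ≡ ∣ ∁ X ∣ !
  hit-total : (∀ X → ∣ ∁ X ∣ ≡ 0 → Φ X ≡ true) → ∀ j X → ∣ ∁ X ∣ < j →
              hit Φ (λ Y → ∣ ∁ Y ∣ !) j X ≡ ∣ ∁ X ∣ !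
  hit-total top (suc j) X lt with Φ X in eq
  ... | true  = refl
  ... | false = up-hit-total top j X (≤-pred lt) (λ e → contradiction (trans (sym eq) (top X e)) λ ())
  up-hit-total top j X le ne = begin
    up (hit Φ (λ Y → ∣ ∁ Y ∣ !) j) X  ≡⟨ up-cong X (λ Y k → trans
      (hit-total top j Y (≤-trans (≤-reflexive (sym (⋖⇒∣∁∣ k))) le)) (cover-! k)) ⟩
    up (λ _ → pred ∣ ∁ X ∣ !) X       ≡⟨ up-const (pred ∣ ∁ X ∣ !) X ⟩
    ∣ ∁ X ∣ * pred ∣ ∁ X ∣ !          ≡⟨ lem ∣ ∁ X ∣ ne ⟩
    ∣ ∁ X ∣ !                         ∎
    where
    open ≡-Reasoning
    lem : ∀ d → d ≢ 0 → d * pred d ! ≡ d !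
    lem zero    ne = contradiction refl ne
    lem (suc d) _  = refl

  module _ (p : Subset n → ℕ) (p≤ : ∀ X → p X ≤ ∣ ∁ X ∣ !) where

    module _ (t : Fin n) (ℓ : ℕ) (p-t : ∀ Y → lookup Y t ≡ outside → p Y ≡ 0)
             (p-ℓ : ∀ Y → ∣ ∁ Y ∣ < ℓ → p Y ≡ 0) where

      hit-low : ∀ j X → ∣ ∁ X ∣ < ℓ → hit Φ p j X ≡ 0
      hit-low j X lt = hit-zero Φ p j X (λ Y X⊆Y → p-ℓ Y (≤-<-trans
        (+-cancelˡ-≤ ∣ X ∣ _ _ (≤-trans (+-monoˡ-≤ _ (p⊆q⇒∣p∣≤∣q∣ X⊆Y))
           (≤-reflexive (trans (∣X∣+∣∁X∣ Y) (sym (∣X∣+∣∁X∣ X)))))) lt))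

      -- In a uniformly random chain above X ∌ t the element t is equally likely to be added
      -- at each of the |∁ X| steps, and only the first |∁ X| ∸ ℓ of them matter.
      up-hit-through : ∀ j X → lookup X t ≡ outside → up (hit Φ p j) X ≤ (∣ ∁ X ∣ ∸ ℓ) * pred ∣ ∁ X ∣ !
      hit-through : ∀ j X → lookup X t ≡ outside → hit Φ p j X ≤ (∣ ∁ X ∣ ∸ ℓ) * pred ∣ ∁ X ∣ !
      hit-through zero    X e = z≤n
      hit-through (suc j) X e with Φ X
      ... | true  = subst (_≤ _) (sym (p-t X e)) z≤n
      ... | false = up-hit-through j X e
      up-hit-through j X e with ∣ ∁ X ∣ ≤? ℓ
      -- Every cover of `X` already lies too high to receive a payoff.
      ... | yes D≤ℓ = ≤-trans (up-mono X (λ Y k → ≤-reflexive (hit-low j Y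
                         (≤-trans (≤-reflexive (sym (⋖⇒∣∁∣ k))) D≤ℓ))))
                       (≤-trans (≤-reflexive (trans (up-const 0 X) (*-zeroʳ ∣ ∁ X ∣))) z≤n)
      ... | no  D≰ℓ = ≤-trans
        -- The one cover that adds `t` may pay in full; for the others the induction applies.
        (up-through (pred ∣ ∁ X ∣ !) ((pred ∣ ∁ X ∣ ∸ ℓ) * pred (pred ∣ ∁ X ∣) !) _ X t e
          (λ Y k _ → ≤-trans (hit-≤ p p≤ j Y) (≤-reflexive (cover-! k)))
          (λ Y k e′ → ≤-trans (hit-through j Y e′)
             (≤-reflexive (cong (λ d → (pred d ∸ ℓ) * pred (pred d) !) (sym (⋖⇒∣∁∣ k))))))
        (count ∣ ∁ X ∣ (≰⇒> D≰ℓ))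
        where
        count : ∀ d → ℓ < d → pred d ! + pred d * ((pred d ∸ ℓ) * pred (pred d) !) ≤ (d ∸ ℓ) * pred d !
        count (suc d) (s≤s ℓ≤d) = begin
          d ! + d * ((d ∸ ℓ) * pred d !)  ≡⟨ cong (d ! +_) (swap d (d ∸ ℓ) _) ⟩
          d ! + (d ∸ ℓ) * (d * pred d !)  ≤⟨ +-monoʳ-≤ (d !) (*-monoʳ-≤ (d ∸ ℓ) (pred-! d)) ⟩
          d ! + (d ∸ ℓ) * d !             ≡⟨ cong (_* d !) (sym (+-∸-assoc 1 ℓ≤d)) ⟩
          (suc d ∸ ℓ) * d !               ∎
          where
          open ≤-Reasoning
          swap : ∀ x y z → x * (y * z) ≡ y * (x * z)
          swap = solve-∀

    -- A chain that ends in a subset of `Z` takes its first step inside `Z`; `up-within` counts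
    -- these steps, and each is followed by `pred ∣ ∁ X ∣ !` chains.
    up-hit-within : ∀ {X Z} → X ⊆ Z → (∀ Y → ¬ Y ⊆ Z → p Y ≡ 0) → ∀ j →
                    up (hit Φ p j) X ≤ (∣ ∁ X ∣ ∸ ∣ ∁ Z ∣) * pred ∣ ∁ X ∣ !
    up-hit-within X⊆Z p-Z j = up-within _ _ X⊆Z
      (λ Y k → ≤-trans (hit-≤ p p≤ j Y) (≤-reflexive (cover-! k)))
      (λ Y k Y⊈Z → hit-zero Φ p j Y (λ Y′ Y⊆Y′ → p-Z Y′ (λ Y′⊆Z → Y⊈Z (⊆-trans Y⊆Y′ Y′⊆Z))))

-- Chains running from a set into a family

-- The count starts at the covers of `X`, so that `X` itself does not stop the chain. Divided by
-- `∣ ∁ X ∣ !` it is the probability that the next member of `Φ` on a random chain above `X` lies in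
-- `T`.
reach : Family n → Family n → Subset n → ℕ
reach {n} Φ T X = up (hit Φ (pay T) (suc n)) X

avoiding : Fin n → Family n → Family n
avoiding t T Y = T Y ∧ not (lookup Y t)

escaping : Subset n → Family n → Family n
escaping Z T Y = T Y ∧ not (does (Y ⊆? Z))

module _ (Φ T : Family n) where

  private
    split : ∀ P j X → hit Φ (pay T) j X ≡
            hit Φ (pay (λ Y → T Y ∧ P Y)) j X + hit Φ (pay (λ Y → T Y ∧ not (P Y))) j X
    split P j X = trans (hit-cong Φ (pay-split T P) j X) (hit-+ Φ _ _ j X)

    up-split : ∀ P X → reach Φ T X ≡ reach Φ (λ Y → T Y ∧ P Y) X + reach Φ (λ Y → T Y ∧ not (P Y)) X
    up-split P X = trans (up-cong X (λ Y _ → split P (suc n) Y)) (up-+ _ _ X)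

  module _ (ℓ : ℕ) (T-ℓ : ∀ Y → T Y ≡ true → ℓ ≤ ∣ ∁ Y ∣) (t : Fin n) where

    private
      q : Subset n → ℕ
      -- The double negation is the form in which `pay-split` returns the sets containing `t`.
      q = pay (λ Y → T Y ∧ not (not (lookup Y t)))
      q-t : ∀ Y → lookup Y t ≡ outside → q Y ≡ 0
      q-t Y e with T Y | lookup Y t
      q-t Y refl | false | false = refl
      q-t Y refl | true  | false = refl
      q-ℓ : ∀ Y → ∣ ∁ Y ∣ < ℓ → q Y ≡ 0
      q-ℓ Y lt with T Y in eq
      ... | false = refl
      ... | true  = contradiction (T-ℓ Y eq) (<⇒≱ lt)

    -- What is lost are the chains that meet `Φ` first in a member of `T` containing `t`;
    -- `hit-through` bounds their number.
    hit-avoiding : ∀ X → lookup X t ≡ outside → hit Φ (pay T) (suc n) X ≤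
                   hit Φ (pay (avoiding t T)) (suc n) X + (∣ ∁ X ∣ ∸ ℓ) * pred ∣ ∁ X ∣ !
    hit-avoiding X e = ≤-trans (≤-reflexive (split (λ Y → not (lookup Y t)) (suc n) X))
      (+-monoʳ-≤ _ (hit-through Φ q (pay≤ _) t ℓ q-t q-ℓ (suc n) X e))

    reach-avoiding : ∀ X → lookup X t ≡ outside → reach Φ T X ≤
                 reach Φ (avoiding t T) X + (∣ ∁ X ∣ ∸ ℓ) * pred ∣ ∁ X ∣ !
    reach-avoiding X e = ≤-trans (≤-reflexive (up-split (λ Y → not (lookup Y t)) X))
      (+-monoʳ-≤ _ (up-hit-through Φ q (pay≤ _) t ℓ q-t q-ℓ (suc n) X e))

  reach-escaping : ∀ {X Z} → X ⊆ Z → reach Φ T X ≤ reach Φ (escaping Z T) X + (∣ ∁ X ∣ ∸ ∣ ∁ Z ∣) * pred ∣ ∁ X ∣ !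
  reach-escaping {X} {Z} X⊆Z = ≤-trans (≤-reflexive (up-split (λ Y → not (does (Y ⊆? Z))) X))
    (+-monoʳ-≤ _ (up-hit-within Φ _ (pay≤ _) X⊆Z q-Z (suc n)))
    where
    q-Z : ∀ Y → ¬ Y ⊆ Z → pay (λ Y → T Y ∧ not (not (does (Y ⊆? Z)))) Y ≡ 0
    q-Z Y Y⊈Z with T Y | Y ⊆? Z
    ... | false | _     = refl
    ... | true  | no _  = refl
    ... | true  | yes s = ⊥-elim (Y⊈Z s)

  reach-pos : ∀ X → 0 < reach Φ T X → ∃ λ Y → X ⊆ Y × T Y ≡ true
  reach-pos X lt =
    let Y , k , lt′ = up-pos _ X lt
        Z , Y⊆Z , q = hit-pos Φ (pay T) (suc n) Y lt′
    in Z , ⊆-trans (⋖⇒⊆ k) Y⊆Z , pay-support T Z q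

reach-mono : (Φ : Family n) {S T : Family n} → S ⊑ T → ∀ X → reach Φ S X ≤ reach Φ T X
reach-mono {n} Φ S⊑T X = up-mono X (λ Y _ → hit-mono Φ (λ Z _ → pay-mono S⊑T Z) (suc n) Y)

reach-≤ : (Φ T : Family n) (X : Subset n) → reach Φ T X ≤ ∣ ∁ X ∣ !
reach-≤ {n} Φ T X = ≤-trans (up-mono X (λ Y _ → hit-≤ Φ _ (pay≤ T) (suc n) Y)) (up-! X)

-- Reversal of chains

-- Double counting of the pairs `X ⋖ Y` with weight `v X * k Y`: the upper covers of `∁ X` are the
-- complements of the lower covers of `X`.
up-adjoint : (v k : Subset n → ℕ) → ΣS (λ X → up (v ∘ ∁) (∁ X) * k X) ≡ ΣS (λ X → v X * up k X)
up-adjoint {zero}  v k = sym (*-zeroʳ (v []))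
up-adjoint {suc n} v k = begin
  ΣS (λ X → up (v₀ ∘ ∁) (∁ X) * k₀ X) + ΣS (λ X → (v (outside ∷ ∁ (∁ X)) + up (v₁ ∘ ∁) (∁ X)) * k₁ X)
    ≡⟨ cong₂ _+_ (up-adjoint v₀ k₀) (ΣS-cong (λ X → trans
         (*-distribʳ-+ (k₁ X) (v (outside ∷ ∁ (∁ X))) _)
         (cong (λ w → v₀ w * k₁ X + up (v₁ ∘ ∁) (∁ X) * k₁ X) (∁-involutive X)))) ⟩
  ΣS (λ X → v₀ X * up k₀ X) + ΣS (λ X → v₀ X * k₁ X + up (v₁ ∘ ∁) (∁ X) * k₁ X)
    ≡⟨ cong (ΣS (λ X → v₀ X * up k₀ X) +_) (trans (ΣS-+ (λ X → v₀ X * k₁ X) _)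
         (cong (ΣS (λ X → v₀ X * k₁ X) +_) (up-adjoint v₁ k₁))) ⟩
  ΣS (λ X → v₀ X * up k₀ X) + (ΣS (λ X → v₀ X * k₁ X) + ΣS (λ X → v₁ X * up k₁ X))
    ≡⟨ rearrange (ΣS (λ X → v₀ X * up k₀ X)) (ΣS (λ X → v₀ X * k₁ X)) _ ⟩
  (ΣS (λ X → v₀ X * k₁ X) + ΣS (λ X → v₀ X * up k₀ X)) + ΣS (λ X → v₁ X * up k₁ X)
    ≡⟨ cong (_+ ΣS (λ X → v₁ X * up k₁ X)) (trans
         (sym (ΣS-+ (λ X → v₀ X * k₁ X) _)) (ΣS-cong (λ X → sym (*-distribˡ-+ (v₀ X) (k₁ X) _)))) ⟩
  ΣS (λ X → v₀ X * (k₁ X + up k₀ X)) + ΣS (λ X → v₁ X * up k₁ X) ∎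
  where
  open ≡-Reasoning
  v₀ = v ∘ (outside ∷_)
  v₁ = v ∘ (inside ∷_)
  k₀ = k ∘ (outside ∷_)
  k₁ = k ∘ (inside ∷_)
  rearrange : ∀ a b c → a + (b + c) ≡ (b + a) + c
  rearrange = solve-∀

-- n! times the probability that a random maximal chain passes from S to T with no element of
-- Φ in between.

μ : Family n → Family n → Family n → ℕ
μ Φ S T = ΣS (λ X → charge S X * reach Φ T X)

-- Both sides count the same segments, followed upwards from `S` or downwards from `T`. In
-- `up-adjoint`, applied to the downward values `v` and the upward values `k`, the sets off `Φ`
-- contribute the same `r` to both sides; what remains after cancelling it are the two sides here.
μ-dual : {Φ S T : Family n} → S ⊑ Φ → T ⊑ Φ → μ Φ S T ≡ μ (Φ ∘ ∁) (T ∘ ∁) (S ∘ ∁)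
μ-dual {n} {Φ} {S} {T} S⊑Φ T⊑Φ = sym (trans (sym (ΣS-∁ (λ X → charge (T ∘ ∁) X * reach (Φ ∘ ∁) (S ∘ ∁) X))) (trans
  (ΣS-cong (λ X → cong (_* dn X) (charge-∁ T X)))
  (+-cancelʳ-≡ (ΣS r) _ _ (trans (sym (ΣS-+ _ r)) (trans
    (ΣS-cong lhs) (trans (up-adjoint v k) (trans (ΣS-cong rhs) (ΣS-+ _ r))))))))
  where
  k v° v dn r : Subset n → ℕ
  k = hit Φ (pay T) (suc n)
  v° = hit (Φ ∘ ∁) (pay (S ∘ ∁)) (suc n)
  v X = v° (∁ X)
  dn X = up v° (∁ X)
  r X = if Φ X then 0 else dn X * up k X
  ∣∁∣≤ : (X : Subset n) → ∣ ∁ X ∣ < suc n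
  ∣∁∣≤ X = s≤s (≤-trans (m≤n+m _ _) (≤-reflexive (∣X∣+∣∁X∣ X)))
  k-fix : ∀ X → k X ≡ (if Φ X then pay T X else up k X)
  k-fix X = hit-stable Φ (pay T) (suc n) X (∣∁∣≤ X)
  v-fix : ∀ X → v X ≡ (if Φ X then charge S X else dn X)
  v-fix X = trans (hit-stable (Φ ∘ ∁) _ (suc n) (∁ X) (∣∁∣≤ (∁ X)))
    (cong₂ (λ b w → if b then w else dn X) (cong Φ (∁-involutive X)) (pay-∁ S X))
  up-v : ∀ X → up (v ∘ ∁) (∁ X) ≡ dn X
  up-v X = up-cong (∁ X) (λ Y _ → cong v° (∁-involutive Y))
  lhs : ∀ X → pay T X * dn X + r X ≡ up (v ∘ ∁) (∁ X) * k X
  lhs X rewrite up-v X | k-fix X with Φ X in eq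
  ... | true  = trans (+-identityʳ _) (*-comm (pay T X) (dn X))
  ... | false with T X in eq′
  ...   | false = refl
  ...   | true  = contradiction (trans (sym eq) (T⊑Φ X eq′)) λ ()
  rhs : ∀ X → v X * up k X ≡ charge S X * up k X + r X
  rhs X rewrite v-fix X with Φ X in eq
  ... | true  = sym (+-identityʳ _)
  ... | false with S X in eq′
  ...   | false = refl
  ...   | true  = contradiction (trans (sym eq) (S⊑Φ X eq′)) λ ()

≤ᵇ-true : ∀ {m n} → (m ≤ᵇ n) ≡ true → m ≤ n
≤ᵇ-true {m} {n} e = ≤ᵇ⇒≤ m n (Equivalence.from Bool.T-≡ e)

true-≤ᵇ : ∀ {m n} → m ≤ n → (m ≤ᵇ n) ≡ true
true-≤ᵇ m≤n = Equivalence.to Bool.T-≡ (≤⇒≤ᵇ m≤n)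

≤ᵇ-false : ∀ {m n} → (m ≤ᵇ n) ≡ false → n ≤ m
≤ᵇ-false {m} {n} e = ≰⇒≥ (λ m≤n → contradiction (trans (sym (true-≤ᵇ m≤n)) e) λ ())

-- Single steps of a walk

avoidingAll : List (Fin n) → Family n → Family n
avoidingAll R T = foldr avoiding T R

avoidingAll-true : ∀ R (T : Family n) Y → avoidingAll R T Y ≡ true →
                   T Y ≡ true × All (λ t → lookup Y t ≡ outside) R
avoidingAll-true []      T Y e = e , []
avoidingAll-true (t ∷ R) T Y e =
  let e₁ , e₂ = ∧-true e
      e₃ , e₄ = avoidingAll-true R T Y e₁
  in e₃ , not-true e₂ ∷ e₄
  where
  not-true : ∀ {b} → not b ≡ true → b ≡ false
  not-true {false} _ = refl

escaping-true : ∀ Z (T : Family n) Y → escaping Z T Y ≡ true → T Y ≡ true × ¬ Y ⊆ Z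
escaping-true Z T Y e with ∧-true {T Y} e
... | e₁ , e₂ = e₁ , λ Y⊆Z → contradiction (trans (sym e₂) (cong not (dec-true (Y ⊆? Z) Y⊆Z))) λ ()

module _ (Φ T : Family n) {L : ℕ} (X : Subset n)
         (near : ∀ Y → T Y ≡ true → ∣ ∁ X ∣ ≤ ∣ ∁ Y ∣ + L) where

  private
    D! : ℕ
    D! = pred ∣ ∁ X ∣ !

    near∸ : ∀ Y → T Y ≡ true → ∣ ∁ X ∣ ∸ L ≤ ∣ ∁ Y ∣
    near∸ Y e = m≤n+o⇒m∸n≤o ∣ ∁ X ∣ L (≤-trans (near Y e) (≤-reflexive (+-comm _ L)))

    gain : ∀ {x y z} m → x ≤ y + m → y ≤ z + (∣ ∁ X ∣ ∸ (∣ ∁ X ∣ ∸ L)) * D! → x ≤ z + (L * D! + m)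
    gain {x} {y} {z} m x≤ y≤ = begin
      x                      ≤⟨ x≤ ⟩
      y + m                  ≤⟨ +-monoˡ-≤ m y≤ ⟩
      z + (∣ ∁ X ∣ ∸ (∣ ∁ X ∣ ∸ L)) * D! + m ≤⟨ +-monoˡ-≤ m (+-monoʳ-≤ z (*-monoˡ-≤ D! (m∸[m∸n]≤n ∣ ∁ X ∣ L))) ⟩
      z + L * D! + m         ≡⟨ +-assoc z _ m ⟩
      z + (L * D! + m)       ∎
      where
      open ≤-Reasoning
      m∸[m∸n]≤n : ∀ m n → m ∸ (m ∸ n) ≤ n
      m∸[m∸n]≤n m n = m≤n+o⇒m∸n≤o m (m ∸ n) (≤-trans (m≤n+m∸n m n) (≤-reflexive (+-comm n _)))

  -- The members of `T` lie at most `L` levels above `X`, so avoiding one more element costs at most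
  -- `L * D!` chains.
  reach-avoidingAll : ∀ R → All (λ t → lookup X t ≡ outside) R →
                  reach Φ T X ≤ reach Φ (avoidingAll R T) X + length R * L * D!
  reach-avoidingAll []      []      = ≤-reflexive (sym (+-identityʳ _))
  reach-avoidingAll (t ∷ R) (e ∷ es) = ≤-trans
    (gain (length R * L * D!) (reach-avoidingAll R es)
      (reach-avoiding Φ (avoidingAll R T) (∣ ∁ X ∣ ∸ L)
        (λ Y e → near∸ Y (proj₁ (avoidingAll-true R T Y e))) t X e))
    (≤-reflexive (cong (reach Φ (avoidingAll (t ∷ R) T) X +_) (sym (*-distribʳ-+ D! L (length R * L)))))

  hit-avoidingAll : ∀ R → All (λ t → lookup X t ≡ outside) R → hit Φ (pay T) (suc n) X ≤
                    hit Φ (pay (avoidingAll R T)) (suc n) X + length R * L * D!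
  hit-avoidingAll []      []      = ≤-reflexive (sym (+-identityʳ _))
  hit-avoidingAll (t ∷ R) (e ∷ es) = ≤-trans
    (gain (length R * L * D!) (hit-avoidingAll R es)
      (hit-avoiding Φ (avoidingAll R T) (∣ ∁ X ∣ ∸ L)
        (λ Y e → near∸ Y (proj₁ (avoidingAll-true R T Y e))) t X e))
    (≤-reflexive (cong (hit Φ (pay (avoidingAll (t ∷ R) T)) (suc n) X +_)
      (sym (*-distribʳ-+ D! L (length R * L)))))

  private
    -- With `y = 0` the `c * D!` lost chains would be at least a `1 / δ` part of all chains from
    -- `X`, against `δ * c < ∣ ∁ X ∣`.
    exceeds : ∀ {x y} δ c → ∣ ∁ X ∣ ! ≤ δ * x → x ≤ y + c * D! → δ * c < ∣ ∁ X ∣ → 0 < y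
    exceeds {x} {zero}  δ c D!≤ x≤ lt = contradiction bound (<⇒≱ (strict ∣ ∁ X ∣ lt))
      where
      bound : ∣ ∁ X ∣ ! ≤ δ * c * D!
      bound = ≤-trans D!≤ (≤-trans (*-monoʳ-≤ δ x≤) (≤-reflexive (sym (*-assoc δ c D!))))
      strict : ∀ d → δ * c < d → δ * c * pred d ! < d !
      strict (suc d) lt = *-monoˡ-< (d !) {{d !≢0}} lt
    exceeds {x} {suc y} δ c D!≤ x≤ lt = z<s

  -- A `1 / δ` part of the chains above `X` runs into `T`. Each element of `R`, and `Z` as well,
  -- spoils at most `L * D!` of them, and some chain survives.
  up-step : ∀ δ R {Z} → X ⊆ Z → ∣ ∁ X ∣ ≤ ∣ ∁ Z ∣ + L → All (λ t → lookup X t ≡ outside) R →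
            ∣ ∁ X ∣ ! ≤ δ * reach Φ T X → δ * (suc (length R) * L) < ∣ ∁ X ∣ →
            ∃ λ Y → X ⊆ Y × T Y ≡ true × All (λ t → lookup Y t ≡ outside) R × ¬ Y ⊆ Z
  up-step δ R {Z} X⊆Z near-Z es heavy small =
    let Y , X⊆Y , e  = reach-pos Φ (escaping Z (avoidingAll R T)) X (exceeds δ (suc (length R) * L) heavy total small)
        e₁ , Y⊈Z = escaping-true Z (avoidingAll R T) Y e
        e₂ , es′ = avoidingAll-true R T Y e₁
    in Y , X⊆Y , e₂ , es′ , Y⊈Z
    where
    ∣Z∖X∣≤L : ∣ ∁ X ∣ ∸ ∣ ∁ Z ∣ ≤ L
    ∣Z∖X∣≤L = m≤n+o⇒m∸n≤o ∣ ∁ X ∣ ∣ ∁ Z ∣ near-Z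
    total : reach Φ T X ≤ reach Φ (escaping Z (avoidingAll R T)) X + suc (length R) * L * D!
    total = begin
      reach Φ T X                                         ≤⟨ reach-avoidingAll R es ⟩
      reach Φ (avoidingAll R T) X + length R * L * D!     ≤⟨ +-monoˡ-≤ _ (reach-escaping Φ (avoidingAll R T) X⊆Z) ⟩
      h′ + (∣ ∁ X ∣ ∸ ∣ ∁ Z ∣) * D! + length R * L * D!
        ≤⟨ +-monoˡ-≤ _ (+-monoʳ-≤ h′ (*-monoˡ-≤ D! ∣Z∖X∣≤L)) ⟩
      h′ + L * D! + length R * L * D!                 ≡⟨ collect h′ L D! (length R) ⟩
      h′ + suc (length R) * L * D!                    ∎
      where
      open ≤-Reasoning
      h′ = reach Φ (escaping Z (avoidingAll R T)) X
      collect : ∀ a l d r → a + l * d + r * l * d ≡ a + (1 + r) * l * d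
      collect = solve-∀

  -- With `hit` in place of `reach` the endpoint may be `X` itself: in the application `X` arises by
  -- adding `v` and may already belong to the family.
  last-step : ∀ δ R → All (λ t → lookup X t ≡ outside) R →
              ∣ ∁ X ∣ ! ≤ δ * hit Φ (pay T) (suc n) X → δ * (length R * L) < ∣ ∁ X ∣ →
              ∃ λ Y → X ⊆ Y × T Y ≡ true × All (λ t → lookup Y t ≡ outside) R
  last-step δ R es heavy small =
    let Y , X⊆Y , p = hit-pos Φ _ (suc n) X (exceeds δ (length R * L) heavy (hit-avoidingAll R es) small)
        e , es′ = avoidingAll-true R T Y (pay-support (avoidingAll R T) Y p)
    in Y , X⊆Y , e , es′

lookup-∁ : ∀ (X : Subset n) t → lookup (∁ X) t ≡ not (lookup X t)
lookup-∁ X t = lookup-map t not X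

⊆-∁ˡ : {X Y : Subset n} → ∁ X ⊆ Y → ∁ Y ⊆ X
⊆-∁ˡ {X = X} {Y} s = subst (∁ Y ⊆_) (∁-involutive X) (p⊆q⇒∁p⊇∁q s)

down-step : (Φ T : Family n) {L : ℕ} (X : Subset n) → (∀ Y → T Y ≡ true → ∣ X ∣ ≤ ∣ Y ∣ + L) →
            ∀ δ K {Z} → Z ⊆ X → ∣ X ∣ ≤ ∣ Z ∣ + L → All (λ t → lookup X t ≡ inside) K →
            ∣ X ∣ ! ≤ δ * reach (Φ ∘ ∁) (T ∘ ∁) (∁ X) → δ * (suc (length K) * L) < ∣ X ∣ →
            ∃ λ Y → Y ⊆ X × T Y ≡ true × All (λ t → lookup Y t ≡ inside) K × ¬ Z ⊆ Y
down-step Φ T {L} X near δ K {Z} Z⊆X near-Z es heavy small =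
  let Y , X⊆Y , e , es′ , Y⊈Z = up-step (Φ ∘ ∁) (T ∘ ∁) {L} (∁ X)
        (λ Y e → subst₂ (λ x y → ∣ x ∣ ≤ y + L) (sym X″) refl (near (∁ Y) e)) δ K
        (p⊆q⇒∁p⊇∁q Z⊆X)
        (subst₂ (λ x y → ∣ x ∣ ≤ ∣ y ∣ + L) (sym X″) (sym (∁-involutive Z)) near-Z)
        (All.map (λ {t} e → trans (lookup-∁ X t) (cong not e)) es)
        (subst (λ x → ∣ x ∣ ! ≤ δ * reach (Φ ∘ ∁) (T ∘ ∁) (∁ X)) (sym X″) heavy)
        (subst (λ x → δ * (suc (length K) * L) < ∣ x ∣) (sym X″) small)
  in ∁ Y , ⊆-∁ˡ X⊆Y , e , All.map (λ {t} e → trans (lookup-∁ Y t) (cong not e)) es′ ,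
     λ Z⊆∁Y → Y⊈Z (subst (_⊆ ∁ Z) (∁-involutive Y) (p⊆q⇒∁p⊇∁q Z⊆∁Y))
  where
  X″ = ∁-involutive X

-- Mass and pruning

charge-pos : (S : Family n) (X : Subset n) → 0 < charge S X → S X ≡ true
charge-pos S X p with S X
... | true = refl

charge-mono : {S T : Family n} → S ⊑ T → ∀ X → charge S X ≤ charge T X
charge-mono {S = S} {T} S⊑T X with S X | T X | S⊑T X
... | false | _     | _ = z≤n
... | true  | true  | _ = ≤-refl
... | true  | false | f = contradiction (f refl) λ ()

μ-mono : (Φ : Family n) {S S′ T T′ : Family n} → S ⊑ S′ → T ⊑ T′ → μ Φ S T ≤ μ Φ S′ T′
μ-mono Φ S⊑S′ T⊑T′ = ΣS-mono (λ X → *-mono-≤ (charge-mono S⊑S′ X) (reach-mono Φ T⊑T′ X))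

-- `n !` times the expected number of members of `S` on a random maximal chain, that is, `n !` times
-- the LYM sum.
mass : Family n → ℕ
mass S = ΣS (λ X → charge S X * ∣ ∁ X ∣ !)

mass-mono : {S T : Family n} → S ⊑ T → mass S ≤ mass T
mass-mono S⊑T = ΣS-mono (λ X → *-monoˡ-≤ (∣ ∁ X ∣ !) (charge-mono S⊑T X))

mass-∁ : (S : Family n) → mass (S ∘ ∁) ≡ mass S
mass-∁ S = trans (sym (ΣS-∁ (λ X → charge (S ∘ ∁) X * ∣ ∁ X ∣ !))) (ΣS-cong same)
  where
  same : ∀ X → charge (S ∘ ∁) (∁ X) * ∣ ∁ (∁ X) ∣ ! ≡ charge S X * ∣ ∁ X ∣ !
  same X rewrite ∁-involutive X with S X
  ... | true  = *-comm (∣ ∁ X ∣ !) _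
  ... | false = refl

-- The members of `S` from which a random upward chain next meets `Φ` inside `T` with probability at
-- least `1 / δ`.
heavy : ℕ → (Φ S T : Family n) → Family n
heavy δ Φ S T X = S X ∧ (∣ ∁ X ∣ ! ≤ᵇ δ * reach Φ T X)

heavyᵈ : ℕ → (Φ S T : Family n) → Family n
heavyᵈ δ Φ S T X = T X ∧ (∣ X ∣ ! ≤ᵇ δ * reach (Φ ∘ ∁) (S ∘ ∁) (∁ X))

heavy-true : ∀ δ (Φ S T : Family n) X → heavy δ Φ S T X ≡ true → S X ≡ true × ∣ ∁ X ∣ ! ≤ δ * reach Φ T X
heavy-true δ Φ S T X e = let e₁ , e₂ = ∧-true {S X} e in e₁ , ≤ᵇ-true e₂

heavyᵈ-true : ∀ δ (Φ S T : Family n) X → heavyᵈ δ Φ S T X ≡ true →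
              T X ≡ true × ∣ X ∣ ! ≤ δ * reach (Φ ∘ ∁) (S ∘ ∁) (∁ X)
heavyᵈ-true δ Φ S T X e = let e₁ , e₂ = ∧-true {T X} e in e₁ , ≤ᵇ-true e₂

-- A discarded `X` contributes to `δ * μ Φ S T` no more than its own share `∣ X ∣ ! * ∣ ∁ X ∣ !` of
-- the mass.
prune : ∀ δ (Φ S T : Family n) → δ * μ Φ S T ≤ δ * μ Φ (heavy δ Φ S T) T + mass S
prune δ Φ S T = begin
  δ * μ Φ S T                                                    ≡⟨ sym (ΣS-* δ (λ X → charge S X * reach Φ T X)) ⟩
  ΣS (λ X → δ * (charge S X * reach Φ T X))                          ≤⟨ ΣS-mono pointwise ⟩
  ΣS (λ X → δ * (charge H X * reach Φ T X) + charge S X * ∣ ∁ X ∣ !) ≡⟨ ΣS-+ _ (λ X → charge S X * ∣ ∁ X ∣ !) ⟩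
  ΣS (λ X → δ * (charge H X * reach Φ T X)) + mass S                 ≡⟨ cong (_+ mass S) (ΣS-* δ (λ X → charge H X * reach Φ T X)) ⟩
  δ * μ Φ H T + mass S                                           ∎
  where
  open ≤-Reasoning
  H = heavy δ Φ S T
  pointwise : ∀ X → δ * (charge S X * reach Φ T X) ≤
                    δ * (charge H X * reach Φ T X) + charge S X * ∣ ∁ X ∣ !
  pointwise X with S X | ∣ ∁ X ∣ ! ≤ᵇ δ * reach Φ T X in eq
  ... | false | _     = ≤-trans (≤-reflexive (*-zeroʳ δ)) z≤n
  ... | true  | true  = m≤m+n _ _
  ... | true  | false = begin
    δ * (∣ X ∣ ! * reach Φ T X)    ≡⟨ swap δ (∣ X ∣ !) _ ⟩
    ∣ X ∣ ! * (δ * reach Φ T X)    ≤⟨ *-monoʳ-≤ (∣ X ∣ !) (≤ᵇ-false {∣ ∁ X ∣ !} eq) ⟩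
    ∣ X ∣ ! * ∣ ∁ X ∣ !        ≤⟨ m≤n+m _ (δ * 0) ⟩
    δ * 0 + ∣ X ∣ ! * ∣ ∁ X ∣ ! ∎
    where
    swap : ∀ x y z → x * (y * z) ≡ y * (x * z)
    swap = solve-∀

pruneᵈ : ∀ δ {Φ S T : Family n} → S ⊑ Φ → T ⊑ Φ →
         δ * μ Φ S T ≤ δ * μ Φ S (heavyᵈ δ Φ S T) + mass T
pruneᵈ δ {Φ} {S} {T} S⊑Φ T⊑Φ = begin
  δ * μ Φ S T                                  ≡⟨ cong (δ *_) (μ-dual S⊑Φ T⊑Φ) ⟩
  δ * μ (Φ ∘ ∁) (T ∘ ∁) (S ∘ ∁)                ≤⟨ prune δ (Φ ∘ ∁) (T ∘ ∁) (S ∘ ∁) ⟩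
  δ * μ (Φ ∘ ∁) H (S ∘ ∁) + mass (T ∘ ∁)
    ≤⟨ +-mono-≤ (*-monoʳ-≤ δ (μ-mono (Φ ∘ ∁) H⊑ (λ _ e → e))) (≤-reflexive (mass-∁ T)) ⟩
  δ * μ (Φ ∘ ∁) (Hᵈ ∘ ∁) (S ∘ ∁) + mass T
    ≡⟨ cong (λ m → δ * m + mass T) (sym (μ-dual S⊑Φ (λ X e → T⊑Φ X (proj₁ (∧-true {T X} e))))) ⟩
  δ * μ Φ S Hᵈ + mass T                        ∎
  where
  open ≤-Reasoning
  H  = heavy δ (Φ ∘ ∁) (T ∘ ∁) (S ∘ ∁)
  Hᵈ = heavyᵈ δ Φ S T
  -- The two families differ only by a double complement.
  H⊑ : H ⊑ Hᵈ ∘ ∁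
  H⊑ X e rewrite ∁-involutive X = e

-- The LYM inequality

-- Stopping at the full set as well makes every chain stop, so that the payoffs add up to |∁ X| !.

full : Family n
full X = ∣ ∁ X ∣ ≡ᵇ 0

withTop : Family n → Family n
withTop F X = F X ∨ full X

⊑withTop : (F : Family n) → F ⊑ withTop F
⊑withTop F X e rewrite e = refl

full⊑withTop : (F : Family n) → full ⊑ withTop F
full⊑withTop F X e with F X
... | true  = refl
... | false = e

ΣS-empty : ∀ n → ΣS {n} (λ X → if ∣ X ∣ ≡ᵇ 0 then 1 else 0) ≡ 1
ΣS-empty zero    = refl
ΣS-empty (suc n) = trans (cong₂ _+_ (ΣS-empty n) (ΣS-* 0 (λ (_ : Subset n) → 0))) refl

-- From a member of `F` a chain goes on either to another member or to the full set, and a maximal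
-- chain does the latter at most once, from its last member of `F`.
mass-≤-μ : (F : Family n) → (∀ X → F X ≡ true → ∣ ∁ X ∣ ≢ 0) →
           mass F ≤ μ (withTop F) F F + n !
mass-≤-μ {n} F not-full = begin
  mass F                                              ≤⟨ ΣS-mono pointwise ⟩
  ΣS (λ X → charge F X * reach Φ F X + charge F X * reach Φ full X) ≡⟨ ΣS-+ _ (λ X → charge F X * reach Φ full X) ⟩
  μ Φ F F + μ Φ F full                                ≤⟨ +-monoʳ-≤ (μ Φ F F) from-top ⟩
  μ Φ F F + n !                                       ∎
  where
  open ≤-Reasoning
  Φ = withTop F
  full-top : ∀ X → ∣ ∁ X ∣ ≡ 0 → Φ X ≡ true
  full-top X e = full⊑withTop F X (cong (_≡ᵇ 0) e)
  ∣∁∣≤ : (X : Subset n) → ∣ ∁ X ∣ ≤ n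
  ∣∁∣≤ X = ≤-trans (m≤n+m _ _) (≤-reflexive (∣X∣+∣∁X∣ X))
  covered : ∀ X → Φ X ≡ true → ∣ ∁ X ∣ ! ≤ pay F X + pay full X
  covered X e with F X | full X
  ... | true  | _     = m≤m+n _ _
  ... | false | true  = ≤-refl
  pointwise : ∀ X → charge F X * ∣ ∁ X ∣ ! ≤ charge F X * reach Φ F X + charge F X * reach Φ full X
  pointwise X with F X in eq
  ... | false = z≤n
  ... | true  = ≤-trans (*-monoʳ-≤ (∣ X ∣ !) (begin
    ∣ ∁ X ∣ !                               ≡⟨ sym (up-hit-total Φ full-top (suc n) X (m≤n⇒m≤1+n (∣∁∣≤ X)) (not-full X eq)) ⟩
    up (hit Φ (λ Y → ∣ ∁ Y ∣ !) (suc n)) X  ≤⟨ up-mono X (λ Y _ → ≤-trans (hit-mono Φ covered (suc n) Y)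
                                                 (≤-reflexive (hit-+ Φ _ _ (suc n) Y))) ⟩
    up (λ Y → hit Φ (pay F) (suc n) Y + hit Φ (pay full) (suc n) Y) X ≡⟨ up-+ _ _ X ⟩
    reach Φ F X + reach Φ full X                    ∎))
    (≤-reflexive (*-distribˡ-+ (∣ X ∣ !) _ _))
  from-top : μ Φ F full ≤ n !
  from-top = begin
    -- Reversed, these segments all start at the empty set, from which there are `n !` chains.
    μ Φ F full                      ≡⟨ μ-dual (⊑withTop F) (full⊑withTop F) ⟩
    μ (Φ ∘ ∁) (full ∘ ∁) (F ∘ ∁)    ≤⟨ ΣS-mono at-bottom ⟩
    ΣS (λ X → n ! * empty X)        ≡⟨ ΣS-* (n !) empty ⟩
    n ! * ΣS empty                  ≡⟨ cong (n ! *_) (ΣS-empty n) ⟩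
    n ! * 1                         ≡⟨ *-identityʳ _ ⟩
    n !                             ∎
    where
    empty : Subset n → ℕ
    empty X = if ∣ X ∣ ≡ᵇ 0 then 1 else 0
    at-bottom : ∀ X → charge (full ∘ ∁) X * reach (Φ ∘ ∁) (F ∘ ∁) X ≤ n ! * empty X
    at-bottom X rewrite ∁-involutive X with ∣ X ∣ in eq
    ... | suc _ = z≤n
    ... | zero  = begin
      1 * reach (Φ ∘ ∁) (F ∘ ∁) X   ≡⟨ *-identityˡ _ ⟩
      reach (Φ ∘ ∁) (F ∘ ∁) X       ≤⟨ reach-≤ (Φ ∘ ∁) (F ∘ ∁) X ⟩
      ∣ ∁ X ∣ !                 ≡⟨ cong _! (trans (cong (_+ ∣ ∁ X ∣) (sym eq)) (∣X∣+∣∁X∣ X)) ⟩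
      n !                       ≡⟨ sym (*-identityʳ _) ⟩
      n ! * 1                   ∎

-- Averaging, and membership by lookup

sum-mono : ∀ {m} {f g : Fin m → ℕ} → (∀ i → f i ≤ g i) → sum f ≤ sum g
sum-mono {zero}  f≤g = z≤n
sum-mono {suc m} f≤g = +-mono-≤ (f≤g zero) (sum-mono (f≤g ∘ suc))

sum-* : ∀ {m} c (f : Fin m → ℕ) → sum (λ i → c * f i) ≡ c * sum f
sum-* {zero}  c f = sym (*-zeroʳ c)
sum-* {suc m} c f = trans (cong (c * f zero +_) (sum-* c (f ∘ suc))) (sym (*-distribˡ-+ c (f zero) _))

sum-ΣS : ∀ {m} (g : Fin m → Subset n → ℕ) → sum (λ i → ΣS (g i)) ≡ ΣS (λ X → sum (λ i → g i X))
sum-ΣS {n} {zero}  g = sym (ΣS-* 0 (λ (_ : Subset n) → 0))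
sum-ΣS {n} {suc m} g = trans (cong (ΣS (g zero) +_) (sum-ΣS (g ∘ suc))) (sym (ΣS-+ (g zero) _))

average : ∀ {m} c (f : Fin m → ℕ) → 0 < m → m * c ≤ sum f → ∃ λ i → c ≤ f i
average {suc m} c f _ le with c ≤? f zero
... | yes c≤ = zero , c≤
... | no  c≰ with m
...   | zero   = contradiction (≤-trans (≤-reflexive (sym (+-identityʳ c))) (≤-trans le (≤-reflexive (+-identityʳ _)))) c≰
...   | suc m′ = let i , c≤ = average c (f ∘ suc) z<s (+-cancelˡ-≤ c _ _
                       (≤-trans le (+-monoˡ-≤ _ (≰⇒≥ c≰)))) in suc i , c≤

up-sum : (f : Subset n → ℕ) (X : Subset n) →
         up f X ≡ sum (λ v → if lookup X v then 0 else f (X [ v ]≔ inside))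
up-sum f []            = refl
up-sum f (inside  ∷ X) = up-sum _ X
up-sum f (outside ∷ X) = cong (f (inside ∷ X) +_) (up-sum _ X)

insert-⋖ : (X : Subset n) (v : Fin n) → lookup X v ≡ outside → X ⋖ X [ v ]≔ inside
insert-⋖ (outside ∷ X) zero    e = here
insert-⋖ (_       ∷ X) (suc v) e = there (insert-⋖ X v e)

⊈-witness : (X Y : Subset n) → ¬ X ⊆ Y → ∃ λ t → lookup X t ≡ inside × lookup Y t ≡ outside
⊈-witness []            []            s = contradiction (λ {x} → id) s
⊈-witness (inside  ∷ X) (outside ∷ Y) s = zero , refl , refl
⊈-witness (inside  ∷ X) (inside  ∷ Y) s = let t , e = ⊈-witness X Y (λ X⊆Y → s (s⊆s X⊆Y)) in suc t , e
⊈-witness (outside ∷ X) (_       ∷ Y) s = let t , e = ⊈-witness X Y (λ X⊆Y → s (out⊆ X⊆Y)) in suc t , e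

⊆-lookup : {X Y : Subset n} → X ⊆ Y → ∀ {t} → lookup X t ≡ inside → lookup Y t ≡ inside
⊆-lookup {X = X} {Y} s {t} e = []=⇒lookup (s (lookup⇒[]= t X e))

⊆-lookup-outside : {X Y : Subset n} → X ⊆ Y → ∀ {t} → lookup Y t ≡ outside → lookup X t ≡ outside
⊆-lookup-outside {X = X} s {t} e with lookup X t in eq
... | false = refl
... | true  = trans (sym (⊆-lookup s eq)) e

separated : {X Y : Subset n} {t : Fin n} → lookup X t ≡ inside → lookup Y t ≡ outside → ¬ X ⊆ Y
separated e e′ s = contradiction (trans (sym (⊆-lookup s e)) e′) λ ()

-- Walks without further inclusions

-- A walk a 0 ⊆ b 0 ⊇ a 1 ⊆ b 1 ⊇ … ⊇ a s ⊆ b s continuing a walk … ⊆ B ⊇ a 0, in which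
-- only the last b contains v.  K and R hold the elements gained and lost so far: kept by every
-- later a and avoided by every later b, they rule out inclusions with the earlier sets.
record Walk {n} (F : Family n) (v : Fin n) (s : ℕ) (A B : Subset n) (K R : List (Fin n)) : Set where
  field
    a b    : ℕ → Subset n
    a-zero : a 0 ≡ A
    a∈F    : ∀ j → j ≤ s → F (a j) ≡ true
    b∈F    : ∀ j → j ≤ s → F (b j) ≡ true
    a⊆b    : ∀ j → j ≤ s → a j ⊆ b j
    a⁺⊆b   : ∀ j → j < s → a (suc j) ⊆ b j
    late   : ∀ i j → suc i < j → j ≤ s → ¬ a j ⊆ b i
    early  : ∀ i j → j < i → i ≤ s → ¬ a j ⊆ b i
    fresh  : ∀ j → j < s → ¬ a (suc j) ⊆ B
    keep   : ∀ j → j ≤ s → All (λ t → lookup (a j) t ≡ inside) K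
    avoid  : ∀ j → j ≤ s → All (λ t → lookup (b j) t ≡ outside) R
    v∉b    : ∀ j → j < s → lookup (b j) v ≡ outside
    v∈b    : lookup (b s) v ≡ inside


-- starts s and turns s are to be thought of as the sets from which a walk can go on for s rounds.

module Walking {n} (F : Family n) (v : Fin n) (r : ℕ) (starts turns : ℕ → Family n)
  (starts∈F : ∀ s A → starts s A ≡ true → F A ≡ true)
  (turns∈F : ∀ s B → turns s B ≡ true → F B ≡ true)
  (v∉starts : ∀ s A → starts s A ≡ true → lookup A v ≡ outside)
  (v∉turns : ∀ s B → turns s B ≡ true → lookup B v ≡ outside)
  (ascend : ∀ s A B R → starts (suc s) A ≡ true → F B ≡ true → A ⊆ B →
            All (λ t → lookup A t ≡ outside) R → length R ≤ r →
            ∃ λ B₁ → A ⊆ B₁ × turns s B₁ ≡ true × All (λ t → lookup B₁ t ≡ outside) R × ¬ B₁ ⊆ B)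
  (descend : ∀ s B A K → turns s B ≡ true → F A ≡ true → A ⊆ B →
             All (λ t → lookup B t ≡ inside) K → length K ≤ r →
             ∃ λ A₁ → A₁ ⊆ B × starts s A₁ ≡ true × All (λ t → lookup A₁ t ≡ inside) K × ¬ A ⊆ A₁)
  (exit : ∀ A R → starts 0 A ≡ true → All (λ t → lookup A t ≡ outside) R → All (v ≢_) R → length R ≤ r →
          ∃ λ Y → A ⊆ Y × F Y ≡ true × lookup Y v ≡ inside × All (λ t → lookup Y t ≡ outside) R)
  where

  private
    -- One round `A ⊆ B₁ ⊇ A₁`. Every later `a` keeps `w`, so none fits into `B`; every later `b`
    -- avoids `u`, so `A` fits into none.
    record Round (s : ℕ) (A B : Subset n) (K R : List (Fin n)) : Set where
      field
        B₁ A₁   : Subset n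
        u w     : Fin n
        A⊆B₁    : A ⊆ B₁
        A₁⊆B₁   : A₁ ⊆ B₁
        B₁∈     : turns s B₁ ≡ true
        A₁∈     : starts s A₁ ≡ true
        avoids  : All (λ t → lookup B₁ t ≡ outside) R
        keeps   : All (λ t → lookup A₁ t ≡ inside) (w ∷ K)
        w∉B     : lookup B w ≡ outside
        u∈A     : lookup A u ≡ inside
        u∉A₁    : lookup A₁ u ≡ outside

    round : ∀ s A B K R → starts (suc s) A ≡ true → F B ≡ true → A ⊆ B →
            All (λ t → lookup A t ≡ inside) K → All (λ t → lookup A t ≡ outside) R →
            suc (length K) ≤ r → length R ≤ r → Round s A B K R
    round s A B K R A∈ B∈ A⊆B ks rs lenK lenR =
      let B₁ , A⊆B₁ , B₁∈ , rs₁ , B₁⊈B = ascend s A B R A∈ B∈ A⊆B rs lenR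
          w , w∈B₁ , w∉B = ⊈-witness B₁ B B₁⊈B
          -- The gained element `w` joins `K` before the descent, so that `A₁` keeps it.
          A₁ , A₁⊆B₁ , A₁∈ , ks₁ , A⊈A₁ = descend s B₁ A (w ∷ K) B₁∈ (starts∈F (suc s) A A∈) A⊆B₁
            (w∈B₁ ∷ All.map (⊆-lookup A⊆B₁) ks) lenK
          u , u∈A , u∉A₁ = ⊈-witness A A₁ A⊈A₁
      in record { B₁ = B₁ ; A₁ = A₁ ; u = u ; w = w ; A⊆B₁ = A⊆B₁ ; A₁⊆B₁ = A₁⊆B₁ ; B₁∈ = B₁∈ ; A₁∈ = A₁∈
                ; avoids = rs₁ ; keeps = ks₁ ; w∉B = w∉B ; u∈A = u∈A ; u∉A₁ = u∉A₁ }

  -- Each round adds one element to `K` and one to `R`; the bounds on `length K + s` and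
  -- `length R + s` reserve room for the rounds to come.
  walk : ∀ s A B K R → starts s A ≡ true → F B ≡ true → A ⊆ B →
         All (λ t → lookup A t ≡ inside) K → All (λ t → lookup A t ≡ outside) R → All (v ≢_) R →
         length K + s ≤ r → length R + s ≤ r → Walk F v s A B K R
  walk zero A B K R A∈ B∈ A⊆B ks rs v≢ lenK lenR = record
    -- For `s = 0` only index 0 counts, so constant functions serve.
    { a      = λ _ → A
    ; b      = λ _ → Y
    ; a-zero = refl
    ; a∈F    = λ _ _ → starts∈F 0 A A∈
    ; b∈F    = λ _ _ → proj₁ (proj₂ (proj₂ out))
    ; a⊆b    = λ _ _ → proj₁ (proj₂ out)
    ; a⁺⊆b   = λ _ ()
    ; late   = λ { _ zero () _ ; _ (suc _) _ () }
    ; early  = λ { zero _ () _ ; (suc _) _ _ () }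
    ; fresh  = λ _ ()
    ; keep   = λ _ _ → ks
    ; avoid  = λ _ _ → proj₂ (proj₂ (proj₂ (proj₂ out)))
    ; v∉b    = λ _ ()
    ; v∈b    = proj₁ (proj₂ (proj₂ (proj₂ out)))
    }
    where
    out = exit A R A∈ rs v≢ (m+n≤o⇒m≤o (length R) lenR)
    Y = proj₁ out
  walk (suc s) A B K R A∈ B∈ A⊆B ks rs v≢ lenK lenR = record
    { a      = λ { zero → A ; (suc j) → a j }
    ; b      = λ { zero → B₁ ; (suc j) → b j }
    ; a-zero = refl
    ; a∈F    = λ { zero _ → starts∈F (suc s) A A∈ ; (suc j) (s≤s j≤s) → a∈F j j≤s }
    ; b∈F    = λ { zero _ → turns∈F s B₁ B₁∈ ; (suc j) (s≤s j≤s) → b∈F j j≤s }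
    ; a⊆b    = λ { zero _ → A⊆B₁ ; (suc j) (s≤s j≤s) → a⊆b j j≤s }
    ; a⁺⊆b   = λ { zero _ → subst (_⊆ B₁) (sym a-zero) A₁⊆B₁ ; (suc j) (s≤s j<s) → a⁺⊆b j j<s }
    -- For the rest of the walk `B₁` plays the part of `B`, so its `fresh` excludes inclusions in
    -- the first `b`.
    ; late   = λ { zero    (suc (suc j)) _          (s≤s j<s) → fresh j j<s
                 ; zero    (suc zero)    (s≤s ())   _
                 ; (suc i) (suc j)       (s≤s i+<j) (s≤s j≤s) → late i j i+<j j≤s }
    ; early  = λ { (suc i) zero    _         (s≤s i≤s) → separated u∈A (All.head (avoid i i≤s))
                 ; (suc i) (suc j) (s≤s j<i) (s≤s i≤s) → early i j j<i i≤s }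
    ; fresh  = λ { j (s≤s j≤s) → separated (All.head (keep j j≤s)) w∉B }
    ; keep   = λ { zero _ → ks ; (suc j) (s≤s j≤s) → All.tail (keep j j≤s) }
    ; avoid  = λ { zero _ → avoids ; (suc j) (s≤s j≤s) → All.tail (avoid j j≤s) }
    ; v∉b    = λ { zero _ → v∉turns s B₁ B₁∈ ; (suc j) (s≤s j<s) → v∉b j j<s }
    ; v∈b    = v∈b
    }
    where
    lenK′ : suc (length K) + s ≤ r
    lenK′ = ≤-trans (≤-reflexive (sym (+-suc _ s))) lenK
    lenR′ : suc (length R) + s ≤ r
    lenR′ = ≤-trans (≤-reflexive (sym (+-suc _ s))) lenR
    open Round (round s A B K R A∈ B∈ A⊆B ks rs (m+n≤o⇒m≤o (suc (length K)) lenK′)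
                 (m+n≤o⇒m≤o (length R) lenR))
    -- The elements to be avoided stay different from `v`, which the exit has to add.
    v≢u : v ≢ u
    v≢u refl = contradiction (trans (sym u∈A) (v∉starts (suc s) A A∈)) λ ()
    open Walk (walk s A₁ B₁ (w ∷ K) (u ∷ R) A₁∈ (turns∈F s B₁ B₁∈) A₁⊆B₁ keeps
      (u∉A₁ ∷ All.map (⊆-lookup-outside A₁⊆B₁) avoids) (v≢u ∷ v≢) lenK′ lenR′)

-- Choice of the element `v`

abstract
  -- Reciprocal of the proportion of mass kept by `choose`; `64 = 2 * 4 * 4 * 2` collects the
  -- factors in `weigh`.
  threshold : ℕ → ℕ
  threshold E = 64 * (suc E * suc E)

  threshold-def : ∀ E → 64 * (suc E * suc E) ≡ threshold E
  threshold-def E = refl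

module Extremal {n} (F : Family n) (L : ℕ)
  (near : ∀ X Y → F X ≡ true → F Y ≡ true → ∣ ∁ X ∣ ≤ ∣ ∁ Y ∣ + L)
  (nearᵈ : ∀ X Y → F X ≡ true → F Y ≡ true → ∣ X ∣ ≤ ∣ Y ∣ + L)
  (E : ℕ) (large : mass F ≤ suc E * μ (withTop F) F F) (n>0 : 0 < n)
  (central : ∀ X → F X ≡ true → n ≤ 4 * ∣ ∁ X ∣)
  (room₀ : ∀ X → F X ≡ true → 4 * suc E * L ≤ ∣ ∁ X ∣)
  where

  Φ : Family n
  Φ = withTop F

  -- For `v ∉ X`: the chains from `X` that add `v` first and meet `F` then or later.
  κ : Fin n → Subset n → ℕ
  κ v X = hit Φ (pay F) (suc n) (X [ v ]≔ inside)

  -- Of the chains from `X` that add `v` first, at least a `1 / (4 * suc E)` part meets `F`; this is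
  -- what `exit` lives on.
  good : Fin n → Subset n → Bool
  good v X = not (lookup X v) ∧ (pred ∣ ∁ X ∣ ! ≤ᵇ 4 * suc E * κ v X)

  lower upper : Fin n → Family n
  lower v X = F X ∧ good v X
  upper v   = avoiding v F

  module _ (X : Subset n) (X∈F : F X ≡ true) where

    private
      hX D! goods total : ℕ
      hX    = reach Φ F X
      D!    = pred ∣ ∁ X ∣ !
      goods = sum (λ v → if good v X then 1 else 0)
      total = sum (λ v → if good v X then reach Φ (upper v) X else 0)

      nonempty : ∣ ∁ X ∣ ≢ 0
      nonempty e = <⇒≱ n>0 (≤-trans (central X X∈F) (≤-reflexive (cong (4 *_) e)))

      D*D! : ∣ ∁ X ∣ * D! ≡ ∣ ∁ X ∣ !
      D*D! with ∣ ∁ X ∣ | nonempty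
      ... | zero  | ne = contradiction refl ne
      ... | suc _ | _  = refl

      instance
        D!≢0 : NonZero D!
        D!≢0 = pred ∣ ∁ X ∣ !≢0

      -- Split the chains by the element added first: a good one accounts for at most `D!` chains, a
      -- bad one for at most `D! / (4 * suc E)`.
      few-bad : 4 * suc E * hX ≤ 4 * suc E * goods * D! + ∣ ∁ X ∣ !
      few-bad = begin
        4 * suc E * hX
          ≡⟨ cong (4 * suc E *_) (up-sum _ X) ⟩
        4 * suc E * sum (λ v → if lookup X v then 0 else κ v X)
          ≡⟨ sym (sum-* (4 * suc E) (λ v → if lookup X v then 0 else κ v X)) ⟩
        sum (λ v → 4 * suc E * (if lookup X v then 0 else κ v X))
          ≤⟨ sum-mono pointwise ⟩
        sum (λ v → 4 * suc E * D! * (if good v X then 1 else 0) + (if lookup X v then 0 else D!))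
          ≡⟨ ∑-distrib-+ _ (λ v → if lookup X v then 0 else D!) ⟩
        sum (λ v → 4 * suc E * D! * (if good v X then 1 else 0)) + sum (λ v → if lookup X v then 0 else D!)
          ≡⟨ cong₂ _+_ (sum-* (4 * suc E * D!) (λ v → if good v X then 1 else 0)) (sym (up-sum (λ _ → D!) X)) ⟩
        4 * suc E * D! * goods + up (λ _ → D!) X
          ≡⟨ cong₂ _+_ (swap (4 * suc E) D! goods) (trans (up-const D! X) D*D!) ⟩
        4 * suc E * goods * D! + ∣ ∁ X ∣ ! ∎
        where
        open ≤-Reasoning
        swap : ∀ a b c → a * b * c ≡ a * c * b
        swap = solve-∀
        pointwise : ∀ v → 4 * suc E * (if lookup X v then 0 else κ v X) ≤
                    4 * suc E * D! * (if good v X then 1 else 0) + (if lookup X v then 0 else D!)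
        pointwise v with lookup X v in eq
        ... | true  = ≤-trans (≤-reflexive (*-zeroʳ (4 * suc E))) z≤n
        ... | false with D! ≤ᵇ 4 * suc E * κ v X in eq′
        ...   | true  = ≤-trans (*-monoʳ-≤ (4 * suc E) κ≤) (≤-trans (≤-reflexive (sym (*-identityʳ _))) (m≤m+n _ _))
          where
          κ≤ : κ v X ≤ D!
          κ≤ = ≤-trans (hit-≤ Φ (pay F) (pay≤ F) (suc n) _) (≤-reflexive (cover-! (insert-⋖ X v eq)))
        ...   | false = ≤-trans (≤ᵇ-false {D!} eq′) (m≤n+m _ _)

      module _ (rich : ∣ ∁ X ∣ ! ≤ 2 * suc E * hX) where

        -- Doubled, `rich` yields two copies of `∣ ∁ X ∣ !`; the bad elements use up only one of
        -- them in `few-bad`.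
        many-good : ∣ ∁ X ∣ ≤ 4 * suc E * goods
        many-good = *-cancelʳ-≤ _ _ D! (≤-trans (≤-reflexive D*D!) (+-cancelʳ-≤ (∣ ∁ X ∣ !) _ _ (begin
          ∣ ∁ X ∣ ! + ∣ ∁ X ∣ !                  ≤⟨ +-mono-≤ rich rich ⟩
          2 * suc E * hX + 2 * suc E * hX        ≡⟨ double (suc E) hX ⟩
          4 * suc E * hX                         ≤⟨ few-bad ⟩
          4 * suc E * goods * D! + ∣ ∁ X ∣ !     ∎)))
          where
          open ≤-Reasoning
          double : ∀ a b → 2 * a * b + 2 * a * b ≡ 4 * a * b
          double = solve-∀

        -- Avoiding `v` costs `L * D!` chains, by `room₀` and `rich` at most half of `hX`.
        half : ∀ v → lookup X v ≡ outside → hX ≤ 2 * reach Φ (upper v) X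
        half v e = +-cancelʳ-≤ hX _ _ (begin
          hX + hX                          ≤⟨ +-mono-≤ loss loss ⟩
          (hv + L * D!) + (hv + L * D!)    ≡⟨ collect hv (L * D!) ⟩
          2 * hv + 2 * (L * D!)            ≤⟨ +-monoʳ-≤ (2 * hv) 2LD!≤hX ⟩
          2 * hv + hX                      ∎)
          where
          open ≤-Reasoning
          hv = reach Φ (upper v) X
          collect : ∀ a b → (a + b) + (a + b) ≡ 2 * a + 2 * b
          collect = solve-∀
          regroup : ∀ a b c → (2 * a) * (2 * (b * c)) ≡ (4 * a * b) * c
          regroup = solve-∀
          loss : hX ≤ hv + L * D!
          loss = ≤-trans (reach-avoidingAll Φ F X (λ Y → near X Y X∈F) (v ∷ []) (e ∷ []))
            (≤-reflexive (cong (λ l → hv + l * D!) (+-identityʳ L)))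
          2LD!≤hX : 2 * (L * D!) ≤ hX
          2LD!≤hX = *-cancelˡ-≤ (2 * suc E) (begin
            2 * suc E * (2 * (L * D!))   ≡⟨ regroup (suc E) L D! ⟩
            4 * suc E * L * D!           ≤⟨ *-monoˡ-≤ D! (room₀ X X∈F) ⟩
            ∣ ∁ X ∣ * D!                 ≡⟨ D*D! ⟩
            ∣ ∁ X ∣ !                    ≤⟨ rich ⟩
            2 * suc E * hX               ∎)

        goods*h : goods * hX ≤ 2 * total
        goods*h = begin
          goods * hX                                       ≡⟨ *-comm goods hX ⟩
          hX * goods                                       ≡⟨ sym (sum-* hX (λ v → if good v X then 1 else 0)) ⟩
          sum (λ v → hX * (if good v X then 1 else 0))     ≤⟨ sum-mono pointwise ⟩
          sum (λ v → 2 * (if good v X then reach Φ (upper v) X else 0)) ≡⟨ sum-* 2 (λ v → if good v X then reach Φ (upper v) X else 0) ⟩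
          2 * total                                        ∎
          where
          open ≤-Reasoning
          pointwise : ∀ v → hX * (if good v X then 1 else 0) ≤
                            2 * (if good v X then reach Φ (upper v) X else 0)
          pointwise v with lookup X v in eq
          ... | true  = ≤-reflexive (*-zeroʳ hX)
          ... | false with D! ≤ᵇ 4 * suc E * κ v X
          ...   | true  = ≤-trans (≤-reflexive (*-identityʳ hX)) (half v eq)
          ...   | false = ≤-reflexive (*-zeroʳ hX)

    -- If at most a `1 / (2 * suc E)` part of the chains from `X` meets `F` again, the first summand
    -- suffices. Otherwise there are at least `n / (16 * suc E)` good elements by `central` and
    -- `many-good`, and for each of them half of the chains remain.
    weigh : 2 * suc E * (n * hX) ≤ n * ∣ ∁ X ∣ ! + threshold E * total
    weigh with 2 * suc E * hX ≤? ∣ ∁ X ∣ !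
    ... | yes poor = ≤-trans (≤-trans (≤-reflexive (swap (2 * suc E) n hX)) (*-monoʳ-≤ n poor)) (m≤m+n _ _)
      where
      swap : ∀ a b c → a * (b * c) ≡ b * (a * c)
      swap = solve-∀
    ... | no ¬poor = ≤-trans (begin
      2 * suc E * (n * hX)                           ≤⟨ *-monoʳ-≤ (2 * suc E) (*-monoˡ-≤ hX (central X X∈F)) ⟩
      2 * suc E * (4 * ∣ ∁ X ∣ * hX)                 ≤⟨ *-monoʳ-≤ (2 * suc E) (*-monoˡ-≤ hX (*-monoʳ-≤ 4 (many-good rich))) ⟩
      2 * suc E * (4 * (4 * suc E * goods) * hX)     ≡⟨ regroup (suc E) goods hX ⟩
      32 * (suc E * suc E) * (goods * hX)            ≤⟨ *-monoʳ-≤ (32 * (suc E * suc E)) (goods*h rich) ⟩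
      32 * (suc E * suc E) * (2 * total)             ≡⟨ regroup′ (suc E * suc E) total ⟩
      64 * (suc E * suc E) * total                   ≡⟨ cong (_* total) (threshold-def E) ⟩
      threshold E * total                            ∎) (m≤n+m _ (n * ∣ ∁ X ∣ !))
      where
      open ≤-Reasoning
      rich = ≰⇒≥ ¬poor
      regroup : ∀ e g x → 2 * e * (4 * (4 * e * g) * x) ≡ 32 * (e * e) * (g * x)
      regroup = solve-∀
      regroup′ : ∀ e t → 32 * e * (2 * t) ≡ 64 * e * t
      regroup′ = solve-∀

  c₀ : ℕ
  c₀ = threshold E

  -- Summed over `X`, `weigh` bounds twice `n * mass F` because of `large`, and its first summand
  -- accounts for one copy. The other copy is averaged over the `n` elements.
  choose : ∃ λ v → mass F ≤ c₀ * μ Φ (lower v) (upper v)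
  choose = average (mass F) (λ v → c₀ * μ Φ (lower v) (upper v)) n>0 (begin
    n * mass F                                             ≤⟨ +-cancelˡ-≤ (n * mass F) _ _ twice ⟩
    c₀ * ΣS (λ X → sum (λ v → charge (lower v) X * reach Φ (upper v) X)) ≡⟨ cong (c₀ *_) (sym (sum-ΣS (λ v X → charge (lower v) X * reach Φ (upper v) X))) ⟩
    c₀ * sum (λ v → μ Φ (lower v) (upper v))               ≡⟨ sym (sum-* c₀ (λ v → μ Φ (lower v) (upper v))) ⟩
    sum (λ v → c₀ * μ Φ (lower v) (upper v))               ∎)
    where
    open ≤-Reasoning
    f₀ f₁ f₂ : Subset n → ℕ
    f₀ X = charge F X * reach Φ F X
    f₁ X = charge F X * ∣ ∁ X ∣ !
    f₂ X = sum (λ v → charge (lower v) X * reach Φ (upper v) X)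
    pointwise : ∀ X → 2 * suc E * n * f₀ X ≤ n * f₁ X + c₀ * f₂ X
    pointwise X with F X in eq
    ... | false = ≤-trans (≤-reflexive (*-zeroʳ (2 * suc E * n))) z≤n
    ... | true  = begin
      2 * suc E * n * (∣ X ∣ ! * reach Φ F X)                     ≡⟨ swap (2 * suc E) n (∣ X ∣ !) _ ⟩
      ∣ X ∣ ! * (2 * suc E * (n * reach Φ F X))                   ≤⟨ *-monoʳ-≤ (∣ X ∣ !) (weigh X eq) ⟩
      ∣ X ∣ ! * (n * ∣ ∁ X ∣ ! + c₀ * t)                      ≡⟨ spread (∣ X ∣ !) n (∣ ∁ X ∣ !) c₀ t ⟩
      n * (∣ X ∣ ! * ∣ ∁ X ∣ !) + c₀ * (∣ X ∣ ! * t)          ≡⟨ cong (λ s → n * (∣ X ∣ ! * ∣ ∁ X ∣ !) + c₀ * s)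
                                                                   (trans (sym (sum-* (∣ X ∣ !) (λ v → if good v X then reach Φ (upper v) X else 0))) (sum-cong-≗ absorb)) ⟩
      n * (∣ X ∣ ! * ∣ ∁ X ∣ !) + c₀ * sum (λ v → (if good v X then ∣ X ∣ ! else 0) * reach Φ (upper v) X) ∎
      where
      t = sum (λ v → if good v X then reach Φ (upper v) X else 0)
      swap : ∀ a b c d → a * b * (c * d) ≡ c * (a * (b * d))
      swap = solve-∀
      spread : ∀ a b c d e → a * (b * c + d * e) ≡ b * (a * c) + d * (a * e)
      spread = solve-∀
      absorb : ∀ v → ∣ X ∣ ! * (if good v X then reach Φ (upper v) X else 0) ≡
                     (if good v X then ∣ X ∣ ! else 0) * reach Φ (upper v) X
      absorb v with good v X
      ... | true  = refl
      ... | false = *-zeroʳ (∣ X ∣ !)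
    twice : n * mass F + n * mass F ≤ n * mass F + c₀ * ΣS f₂
    twice = begin
      n * mass F + n * mass F                 ≤⟨ +-mono-≤ (*-monoʳ-≤ n large) (*-monoʳ-≤ n large) ⟩
      n * (suc E * μ Φ F F) + n * (suc E * μ Φ F F) ≡⟨ regroup n (suc E) (μ Φ F F) ⟩
      2 * suc E * n * ΣS f₀                   ≡⟨ sym (ΣS-* (2 * suc E * n) f₀) ⟩
      ΣS (λ X → 2 * suc E * n * f₀ X)         ≤⟨ ΣS-mono pointwise ⟩
      ΣS (λ X → n * f₁ X + c₀ * f₂ X)         ≡⟨ ΣS-+ _ (λ X → c₀ * f₂ X) ⟩
      ΣS (λ X → n * f₁ X) + ΣS (λ X → c₀ * f₂ X) ≡⟨ cong₂ _+_ (ΣS-* n f₁) (ΣS-* c₀ f₂) ⟩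
      n * mass F + c₀ * ΣS f₂                 ∎
      where
      regroup : ∀ a b c → a * (b * c) + a * (b * c) ≡ 2 * b * a * c
      regroup = solve-∀

  -- Repeated pruning

  module Walks (r : ℕ) (v : Fin n)
    (roomᵘ : ∀ X → F X ≡ true → c₀ * suc (2 * r) * (suc r * L) < ∣ ∁ X ∣)
    (roomᵈ : ∀ X → F X ≡ true → c₀ * suc (2 * r) * (suc r * L) < ∣ X ∣)
    (roomˡ : ∀ X → F X ≡ true → 4 * suc E * (r * L) < pred ∣ ∁ X ∣)
    where

    -- Reaching `starts r` takes `2 * r` prunings, each costing at most `mass F`; the factor
    -- `suc (2 * r)` makes `δ * μ` start at `suc (2 * r) * mass F` or more and outlast them.
    δ : ℕ
    δ = c₀ * suc (2 * r)

    -- Built backwards from the exit, which applies in `starts zero`: many chains lead up from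
    -- `starts (suc s)` into `turns s`, and many lead down from `turns s` into `starts s`.
    starts turns : ℕ → Family n
    starts zero    = lower v
    starts (suc s) = heavy δ Φ (lower v) (turns s)
    turns s        = heavyᵈ δ Φ (starts s) (upper v)

    starts⊑lower : ∀ s → starts s ⊑ lower v
    starts⊑lower zero    X e = e
    starts⊑lower (suc s) X e = proj₁ (heavy-true δ Φ (lower v) (turns s) X e)

    turns⊑upper : ∀ s → turns s ⊑ upper v
    turns⊑upper s X e = proj₁ (heavyᵈ-true δ Φ (starts s) (upper v) X e)

    lower⊑F : lower v ⊑ F
    lower⊑F X e = proj₁ (∧-true {F X} e)

    upper⊑F : upper v ⊑ F
    upper⊑F X e = proj₁ (∧-true {F X} e)

    ∉upper : ∀ X → upper v X ≡ true → lookup X v ≡ outside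
    ∉upper X e with lookup X v | proj₂ (∧-true {F X} e)
    ... | false | _ = refl

    ∉lower : ∀ X → lower v X ≡ true → lookup X v ≡ outside
    ∉lower X e with lookup X v | proj₂ (∧-true {F X} e)
    ... | false | _ = refl

    lower-last : ∀ X → lower v X ≡ true → pred ∣ ∁ X ∣ ! ≤ 4 * suc E * κ v X
    lower-last X e = ≤ᵇ-true (proj₂ (∧-true {not (lookup X v)} (proj₂ (∧-true {F X} e))))

    starts∈F : ∀ s A → starts s A ≡ true → F A ≡ true
    starts∈F s A e = lower⊑F A (starts⊑lower s A e)

    turns∈F : ∀ s B → turns s B ≡ true → F B ≡ true
    turns∈F s B e = upper⊑F B (turns⊑upper s B e)

    starts-large : ∀ s → δ * μ Φ (lower v) (upper v) ≤ δ * μ Φ (starts s) (upper v) + 2 * s * mass F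
    starts-large zero    = m≤m+n _ _
    starts-large (suc s) = begin
      δ * μ Φ (lower v) (upper v)                       ≤⟨ starts-large s ⟩
      δ * μ Φ (starts s) (upper v) + 2 * s * mass F     ≤⟨ +-monoˡ-≤ _ (pruneᵈ δ
        (λ X e → ⊑withTop F X (lower⊑F X (starts⊑lower s X e))) (λ X e → ⊑withTop F X (upper⊑F X e))) ⟩
      δ * μ Φ (starts s) (turns s) + mass (upper v) + 2 * s * mass F
        ≤⟨ +-monoˡ-≤ _ (+-monoˡ-≤ _ (*-monoʳ-≤ δ (μ-mono Φ (starts⊑lower s) (λ X e → e)))) ⟩
      δ * μ Φ (lower v) (turns s) + mass (upper v) + 2 * s * mass F
        ≤⟨ +-monoˡ-≤ _ (+-monoˡ-≤ _ (prune δ Φ (lower v) (turns s))) ⟩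
      δ * μ Φ (starts (suc s)) (turns s) + mass (lower v) + mass (upper v) + 2 * s * mass F
        ≤⟨ +-monoˡ-≤ _ (+-mono-≤ (+-mono-≤ (*-monoʳ-≤ δ (μ-mono Φ {starts (suc s)} (λ X e → e) (turns⊑upper s)))
             (mass-mono lower⊑F)) (mass-mono upper⊑F)) ⟩
      δ * μ Φ (starts (suc s)) (upper v) + mass F + mass F + 2 * s * mass F
        ≡⟨ collect (δ * μ Φ (starts (suc s)) (upper v)) (mass F) s ⟩
      δ * μ Φ (starts (suc s)) (upper v) + 2 * suc s * mass F ∎
      where
      open ≤-Reasoning
      collect : ∀ a m s → a + m + m + 2 * s * m ≡ a + 2 * (1 + s) * m
      collect = solve-∀

    starts-nonempty : 0 < mass F → mass F ≤ c₀ * μ Φ (lower v) (upper v) → ∃ λ A → starts r A ≡ true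
    starts-nonempty m>0 m≤ with μ Φ (starts r) (upper v) in eq
    ... | zero  = contradiction (begin
        suc (2 * r) * mass F                                     ≤⟨ *-monoʳ-≤ (suc (2 * r)) m≤ ⟩
        suc (2 * r) * (c₀ * μ Φ (lower v) (upper v))             ≡⟨ swap (suc (2 * r)) c₀ _ ⟩
        δ * μ Φ (lower v) (upper v)                              ≤⟨ starts-large r ⟩
        δ * μ Φ (starts r) (upper v) + 2 * r * mass F            ≡⟨ cong (λ m → δ * m + 2 * r * mass F) eq ⟩
        δ * 0 + 2 * r * mass F                                   ≡⟨ cong (_+ 2 * r * mass F) (*-zeroʳ δ) ⟩
        2 * r * mass F                                           ∎)
        (<⇒≱ (m<n+m (2 * r * mass F) m>0))
      where
      open ≤-Reasoning
      swap : ∀ a b c → a * (b * c) ≡ b * a * c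
      swap = solve-∀
    ... | suc _ = let A , p = ΣS-pos _ (subst (0 <_) (sym eq) z<s)
                  in A , charge-pos (starts r) A (m*n≢0⇒m≢0′ (charge (starts r) A) p)
      where
      m*n≢0⇒m≢0′ : ∀ a {b} → 0 < a * b → 0 < a
      m*n≢0⇒m≢0′ (suc a) _ = z<s

    ascend : ∀ s A B R → starts (suc s) A ≡ true → F B ≡ true → A ⊆ B →
             All (λ t → lookup A t ≡ outside) R → length R ≤ r →
             ∃ λ B₁ → A ⊆ B₁ × turns s B₁ ≡ true × All (λ t → lookup B₁ t ≡ outside) R × ¬ B₁ ⊆ B
    ascend s A B R A∈ B∈ A⊆B rs len = up-step Φ (turns s) {L} A
      (λ Y Y∈ → near A Y A∈F (turns∈F s Y Y∈)) δ R A⊆B (near A B A∈F B∈) rs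
      (proj₂ (heavy-true δ Φ (lower v) (turns s) A A∈))
      (≤-<-trans (*-monoʳ-≤ δ (*-monoˡ-≤ L (s≤s len))) (roomᵘ A A∈F))
      where A∈F = starts∈F (suc s) A A∈

    descend : ∀ s B A K → turns s B ≡ true → F A ≡ true → A ⊆ B →
              All (λ t → lookup B t ≡ inside) K → length K ≤ r →
              ∃ λ A₁ → A₁ ⊆ B × starts s A₁ ≡ true × All (λ t → lookup A₁ t ≡ inside) K × ¬ A ⊆ A₁
    descend s B A K B∈ A∈ A⊆B ks len = down-step Φ (starts s) {L} B
      (λ Y Y∈ → nearᵈ B Y B∈F (starts∈F s Y Y∈)) δ K A⊆B (nearᵈ B A B∈F A∈) ks
      (proj₂ (heavyᵈ-true δ Φ (starts s) (upper v) B B∈))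
      (≤-<-trans (*-monoʳ-≤ δ (*-monoˡ-≤ L (s≤s len))) (roomᵈ B B∈F))
      where B∈F = turns∈F s B B∈

    exit : ∀ A R → lower v A ≡ true → All (λ t → lookup A t ≡ outside) R → All (v ≢_) R →
           length R ≤ r →
           ∃ λ Y → A ⊆ Y × F Y ≡ true × lookup Y v ≡ inside × All (λ t → lookup Y t ≡ outside) R
    exit A R A∈ es v≢ len =
      let Y , X⊆Y , Y∈F , es″ = last-step Φ F X
            -- Adding `v` moves up one level, which only brings `X` closer to the sets above it.
            (λ Y Y∈F → ≤-trans (≤-trans (n≤1+n _) (≤-reflexive (sym (⋖⇒∣∁∣ A⋖X)))) (near A Y A∈F Y∈F))
            (4 * suc E) R es′ (subst (λ d → d ! ≤ 4 * suc E * κ v A) (sym ∣∁X∣) (lower-last A A∈))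
            (≤-<-trans (*-monoʳ-≤ (4 * suc E) (*-monoˡ-≤ L len)) (subst (4 * suc E * (r * L) <_) (sym ∣∁X∣) (roomˡ A A∈F)))
      in Y , ⊆-trans (⋖⇒⊆ A⋖X) X⊆Y , Y∈F , ⊆-lookup X⊆Y (lookup∘updateAt v A) , es″
      where
      X = A [ v ]≔ inside
      A∈F = lower⊑F A A∈
      A⋖X : A ⋖ X
      A⋖X = insert-⋖ A v (∉lower A A∈)
      ∣∁X∣ : ∣ ∁ X ∣ ≡ pred ∣ ∁ A ∣
      ∣∁X∣ = cong pred (sym (⋖⇒∣∁∣ A⋖X))
      es′ : All (λ t → lookup X t ≡ outside) R
      es′ = All.zipWith (λ {t} (e , v≢t) → trans (lookup∘updateAt′ t v (v≢t ∘ sym) A) e) (es , v≢)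

    -- An exit taken at once from the first set `A` supplies the `B` before the walk, so that `v`
    -- lies in the first and in the last upper set.
    closed-walk : 0 < mass F → mass F ≤ c₀ * μ Φ (lower v) (upper v) →
                  ∃ λ A → ∃ λ B → A ⊆ B × F B ≡ true × lookup B v ≡ inside × Walk F v r A B [] []
    closed-walk m>0 m≤ =
      let A , A∈ = starts-nonempty m>0 m≤
          B , A⊆B , B∈F , v∈B , _ = exit A [] (starts⊑lower r A A∈) [] [] z≤n
      in A , B , A⊆B , B∈F , v∈B ,
         Walking.walk F v r starts turns starts∈F turns∈F (λ s A e → ∉lower A (starts⊑lower s A e))
           (λ s B e → ∉upper B (turns⊑upper s B e)) ascend descend exit
           r A B [] [] A∈ B∈F A⊆B [] [] [] ≤-refl ≤-refl

-- The crown as a cycle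

-- Cyclic succession of indices; the disjuncts match `crown-next` and `crown-wrap`.
Cyc : ℕ → ℕ → ℕ → Set
Cyc k p q = suc p ≡ q ⊎ (suc p ≡ k × q ≡ 0)

module _ {k : ℕ} (3≤k : 3 ≤ k) where

  Cyc-functional : ∀ {p q q′} → q < k → q′ < k → Cyc k p q → Cyc k p q′ → q ≡ q′
  Cyc-functional q<k q′<k (inj₁ refl)       (inj₁ refl)        = refl
  Cyc-functional q<k q′<k (inj₁ refl)       (inj₂ (e , _))     = contradiction e (<⇒≢ q<k)
  Cyc-functional q<k q′<k (inj₂ (e , _))    (inj₁ refl)        = contradiction e (<⇒≢ q′<k)
  Cyc-functional q<k q′<k (inj₂ (_ , refl)) (inj₂ (_ , refl))  = refl

  Cyc-irrefl : ∀ {p} → ¬ Cyc k p p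
  Cyc-irrefl (inj₁ e)             = 1+n≢n e
  Cyc-irrefl (inj₂ (refl , refl)) = <⇒≱ (s≤s z<s) 3≤k

  Cyc-asym : ∀ {p q} → Cyc k p q → ¬ Cyc k q p
  Cyc-asym (inj₁ refl)          (inj₁ e)             = <⇒≢ (m<n⇒m<1+n (n<1+n _)) (sym e)
  Cyc-asym (inj₁ refl)          (inj₂ (refl , refl)) = <⇒≱ ≤-refl 3≤k
  Cyc-asym (inj₂ (refl , refl)) (inj₁ refl)          = <⇒≱ ≤-refl 3≤k
  Cyc-asym (inj₂ (refl , refl)) (inj₂ (_ , refl))    = <⇒≱ (s≤s z<s) 3≤k

  incidence : ∀ {i j} → CrownLe k (inj₁ i) (inj₂ j) → i ≡ j ⊎ Cyc k (toℕ j) (toℕ i)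
  incidence (crown-same i)       = inj₁ refl
  incidence (crown-next i j e)   = inj₂ (inj₁ e)
  incidence (crown-wrap i j e z) = inj₂ (inj₂ (e , z))

  cyclic : ∀ {i j} → Cyc k (toℕ j) (toℕ i) → CrownLe k (inj₁ i) (inj₂ j)
  cyclic (inj₁ e)       = crown-next _ _ e
  cyclic (inj₂ (e , z)) = crown-wrap _ _ e z

cyclic-pred : ∀ {k} (j : Fin k) → ∃ λ p → Cyc k (toℕ {k} p) (toℕ j)
cyclic-pred {suc k} zero    = fromℕ k , inj₂ (cong suc (toℕ-fromℕ k) , refl)
cyclic-pred {suc k} (suc j) = inject₁ j , inj₁ (cong suc (toℕ-inject₁ j))

cyclic-suc : ∀ {k} (i : Fin k) → ∃ λ q → Cyc k (toℕ i) (toℕ {k} q)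
cyclic-suc {suc k} i with suc (toℕ i) ≟ suc k
... | yes e = zero , inj₂ (e , refl)
... | no ne = fromℕ< (≤∧≢⇒< (toℕ<n i) ne) , inj₁ (sym (toℕ-fromℕ< (≤∧≢⇒< (toℕ<n i) ne)))

-- Each element of the crown is determined by the set of its neighbours, so the incidences
-- between the two levels leave no room for further comparabilities.

module _ {k : ℕ} (3≤k : 3 ≤ k) (a b : Fin k → Subset n)
  (to : ∀ i j → CrownLe k (inj₁ i) (inj₂ j) → a i ⊆ b j)
  (from : ∀ i j → a i ⊆ b j → CrownLe k (inj₁ i) (inj₂ j))
  where

  private
    related : ∀ i j → a i ⊆ b j → i ≡ j ⊎ Cyc k (toℕ j) (toℕ i)
    related i j s = incidence 3≤k (from i j s)

    a⊆b : ∀ i → a i ⊆ b i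
    a⊆b i = to i i (crown-same i)

    a-antichain : ∀ i j → a i ⊆ a j → i ≡ j
    a-antichain i j s with cyclic-pred j
    ... | p , p→j with related i j (⊆-trans s (a⊆b j))
                     | related i p (⊆-trans s (to j p (cyclic 3≤k p→j)))
    ...   | inj₁ e   | _         = e
    ...   | inj₂ j→i | inj₁ refl = contradiction j→i (Cyc-asym 3≤k p→j)
    ...   | inj₂ _   | inj₂ p→i  = toℕ-injective (Cyc-functional 3≤k (toℕ<n i) (toℕ<n j) p→i p→j)

    b-antichain : ∀ i j → b i ⊆ b j → i ≡ j
    b-antichain i j s with cyclic-suc i
    ... | q , i→q with related i j (⊆-trans (a⊆b i) s)
                     | related q j (⊆-trans (to q i (cyclic 3≤k i→q)) s)
    ...   | inj₁ e   | _         = e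
    ...   | inj₂ j→i | inj₁ refl = contradiction i→q (Cyc-asym 3≤k j→i)
    ...   | inj₂ j→i | inj₂ j→q  = contradiction
      (subst (Cyc k (toℕ i)) (Cyc-functional 3≤k (toℕ<n q) (toℕ<n i) j→q j→i) i→q) (Cyc-irrefl 3≤k)

    -- Two different lower sets lie below `b i`; inside `a j` both would equal `a j`.
    b⊈a : ∀ i j → ¬ b i ⊆ a j
    b⊈a i j s with cyclic-suc i
    ... | q , i→q = Cyc-irrefl 3≤k (subst (Cyc k (toℕ i))
      (cong toℕ (trans (a-antichain q j (⊆-trans (to q i (cyclic 3≤k i→q)) s))
                       (sym (a-antichain i j (⊆-trans (a⊆b i) s))))) i→q)

  crown-copy : IsStrongCopy n (CrownLe k) [ a , b ]
  crown-copy = injective , λ p q → mk⇔ (⇒ p q) (⇐ p q)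
    where
    f : Fin k ⊎ Fin k → Subset n
    f = [ a , b ]
    ⇒ : ∀ p q → CrownLe k p q → f p ⊆ f q
    ⇒ (inj₁ i) (inj₂ j) c = to i j c
    ⇒ p        .p       (crown-refl .p) = id
    ⇐ : ∀ p q → f p ⊆ f q → CrownLe k p q
    ⇐ (inj₁ i) (inj₁ j) s rewrite a-antichain i j s = crown-refl _
    ⇐ (inj₁ i) (inj₂ j) s = from i j s
    ⇐ (inj₂ i) (inj₁ j) s = contradiction (λ {x} → s {x}) (b⊈a i j)
    ⇐ (inj₂ i) (inj₂ j) s rewrite b-antichain i j s = crown-refl _
    injective : ∀ p q → f p ≡ f q → p ≡ q
    injective (inj₁ i) (inj₁ j) e = cong inj₁ (a-antichain i j (⊆-reflexive e))
    injective (inj₁ i) (inj₂ j) e = ⊥-elim (b⊈a j i (⊆-reflexive (sym e)))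
    injective (inj₂ i) (inj₁ j) e = ⊥-elim (b⊈a i j (⊆-reflexive e))
    injective (inj₂ i) (inj₂ j) e = cong inj₂ (b-antichain i j (⊆-reflexive e))

-- From a closed walk to a rainbow crown

⁅⁆⊆ : {X : Subset n} {v : Fin n} → lookup X v ≡ inside → ⁅ v ⁆ ⊆ X
⁅⁆⊆ {X = X} {v} e x∈ = subst (_∈ X) (sym (x∈⁅y⁆⇒x≡y v x∈)) (lookup⇒[]= v X e)

⁅⁆⊈ : {X : Subset n} {v : Fin n} → lookup X v ≡ outside → ¬ ⁅ v ⁆ ⊆ X
⁅⁆⊈ {v = v} e s = contradiction (trans (sym ([]=⇒lookup (s (x∈⁅x⁆ v)))) e) λ ()

module ClosedWalk {n} (F : Family n) (v : Fin n) (r : ℕ) (A B : Subset n) (A⊆B : A ⊆ B)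
  (B∈F : F B ≡ true) (v∈B : lookup B v ≡ inside) (W : Walk F v (suc r) A B [] [])
  where

  open Walk W

  private
    -- The singleton closes the cycle, lying below `B` and the last `b` only. A walk of `suc r`
    -- rounds has `2 + r` sets of each kind, and `⁅ v ⁆` and `B` make it `3 + r`.
    a′ b′ : Fin (3 + r) → Subset n
    a′ zero    = ⁅ v ⁆
    a′ (suc j) = a (toℕ j)
    b′ zero    = B
    b′ (suc i) = b (toℕ i)

    to : ∀ j i → CrownLe (3 + r) (inj₁ j) (inj₂ i) → a′ j ⊆ b′ i
    to .zero    .zero    (crown-same zero)             = ⁅⁆⊆ v∈B
    to .(suc i) .(suc i) (crown-same (suc i))          = a⊆b (toℕ i) (toℕ≤pred[n] i)
    to .(suc j) .zero    (crown-next zero (suc j) e)   =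
      subst (λ m → a m ⊆ B) (suc-injective e) (subst (_⊆ B) (sym a-zero) A⊆B)
    to .(suc j) .(suc i) (crown-next (suc i) (suc j) e) = subst (λ m → a m ⊆ b (toℕ i)) (suc-injective e)
      (a⁺⊆b (toℕ i) (≤-trans (≤-reflexive (suc-injective e)) (toℕ≤pred[n] j)))
    to .zero    .(suc i) (crown-wrap (suc i) zero e _) =
      ⁅⁆⊆ (subst (λ m → lookup (b m) v ≡ inside) (sym (suc-injective (suc-injective e))) v∈b)

    from : ∀ j i → a′ j ⊆ b′ i → CrownLe (3 + r) (inj₁ j) (inj₂ i)
    from zero    zero    s = crown-same zero
    from zero    (suc i) s with toℕ i ≟ suc r
    ... | yes e = crown-wrap (suc i) zero (cong (λ m → suc (suc m)) e) refl
    ... | no ne = ⊥-elim (⁅⁆⊈ (v∉b (toℕ i) (≤∧≢⇒< (toℕ≤pred[n] i) ne)) s)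
    from (suc zero)    zero s = crown-next zero (suc zero) refl
    from (suc (suc j)) zero s = ⊥-elim (fresh (toℕ j) (toℕ<n j) s)
    from (suc j) (suc i) s with <-cmp (toℕ i) (toℕ j)
    ... | tri≈ _ e _ rewrite toℕ-injective e = crown-same (suc j)
    ... | tri> _ _ j<i = ⊥-elim (early (toℕ i) (toℕ j) j<i (toℕ≤pred[n] i) s)
    ... | tri< i<j _ _ with suc (toℕ i) ≟ toℕ j
    ...   | yes e = crown-next (suc i) (suc j) (cong suc e)
    ...   | no ne = ⊥-elim (late (toℕ i) (toℕ j) (≤∧≢⇒< i<j ne) (toℕ≤pred[n] j) s)

    a∈ : ∀ j → F (a′ (suc j)) ≡ true
    a∈ j = a∈F (toℕ j) (toℕ≤pred[n] j)

    b∈ : ∀ i → F (b′ i) ≡ true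
    b∈ zero    = B∈F
    b∈ (suc i) = b∈F (toℕ i) (toℕ≤pred[n] i)

  rainbow-crown : ∀ {m} (c : Subset n → Fin m) →
                  (∀ X Y → F X ≡ true → F Y ≡ true → c X ≡ c Y → X ≡ Y) →
                  (∀ X → F X ≡ true → c X ≢ c ⁅ v ⁆) →
                  ¬ NoRainbowCopy n m (CrownLe (3 + r)) c
  rainbow-crown c c-injective c-singleton none = none f copy rainbow
    where
    f : Fin (3 + r) ⊎ Fin (3 + r) → Subset n
    f = [ a′ , b′ ]
    copy = crown-copy (s≤s (s≤s (s≤s z≤n))) a′ b′ to from
    F-rainbow : ∀ p q → F (f p) ≡ true → F (f q) ≡ true → c (f p) ≡ c (f q) → p ≡ q
    F-rainbow p q e e′ eq = proj₁ copy p q (c-injective _ _ e e′ eq)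
    rainbow : IsRainbow n _ c f
    rainbow (inj₁ zero)    (inj₁ zero)    e = refl
    rainbow (inj₁ zero)    (inj₁ (suc j)) e = contradiction (sym e) (c-singleton _ (a∈ j))
    rainbow (inj₁ zero)    (inj₂ j)       e = contradiction (sym e) (c-singleton _ (b∈ j))
    rainbow (inj₁ (suc i)) (inj₁ zero)    e = contradiction e (c-singleton _ (a∈ i))
    rainbow (inj₂ i)       (inj₁ zero)    e = contradiction e (c-singleton _ (b∈ i))
    rainbow (inj₁ (suc i)) (inj₁ (suc j)) e = F-rainbow _ _ (a∈ i) (a∈ j) e
    rainbow (inj₁ (suc i)) (inj₂ j)       e = F-rainbow _ _ (a∈ i) (b∈ j) e
    rainbow (inj₂ i)       (inj₁ (suc j)) e = F-rainbow _ _ (b∈ i) (a∈ j) e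
    rainbow (inj₂ i)       (inj₂ j)       e = F-rainbow _ _ (b∈ i) (b∈ j) e

ind : Bool → ℕ
ind b = if b then 1 else 0

sum-≥ : ∀ {m} (f : Fin m → ℕ) i → f i ≤ sum f
sum-≥ f zero    = m≤m+n _ _
sum-≥ f (suc i) = ≤-trans (sum-≥ (f ∘ suc) i) (m≤n+m _ _)

≡ᵇ-refl : ∀ m → (m ≡ᵇ m) ≡ true
≡ᵇ-refl zero    = refl
≡ᵇ-refl (suc m) = ≡ᵇ-refl m

-- Binomial coefficients

nC0≡1 : ∀ n → n C 0 ≡ 1
nC0≡1 n = trans (nCk≡nC[n∸k] {0} {n} z≤n) (nCn≡1 n)

level-size : ∀ n i → ΣS {n} (λ X → ind (∣ X ∣ ≡ᵇ i)) ≡ n C i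
level-size zero    zero    = refl
level-size zero    (suc i) = sym (k>n⇒nCk≡0 {0} {suc i} z<s)
level-size (suc n) zero    = trans (cong₂ _+_ (trans (level-size n zero) (nC0≡1 n))
  (ΣS-* 0 (λ (_ : Subset n) → 0))) (sym (nC0≡1 (suc n)))
level-size (suc n) (suc i) = trans (cong₂ _+_ (level-size n (suc i)) (level-size n i))
  (trans (+-comm (n C suc i) _) (nCk+nC[k+1]≡[n+1]C[k+1] n i))

nCk*k![n∸k]! : ∀ {n k} → k ≤ n → (n C k) * (k ! * (n ∸ k) !) ≡ n !
nCk*k![n∸k]! {n} {k} k≤n = trans (cong (_* (k ! * (n ∸ k) !)) (nCk≡n!/k![n-k]! k≤n))
  (m/n*n≡m {{k !* (n ∸ k) !≢0}} (k![n∸k]!∣n! k≤n))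

-- The `t` factors following `a` are at most the `t` factors following `b`, one by one.
!-exchange : ∀ t {a b} → a ≤ b → (t + a) ! * b ! ≤ a ! * (t + b) !
!-exchange zero    {a} {b} a≤b = ≤-refl
!-exchange (suc t) {a} {b} a≤b = begin
  suc (t + a) * (t + a) ! * b !      ≡⟨ *-assoc (suc (t + a)) ((t + a) !) (b !) ⟩
  suc (t + a) * ((t + a) ! * b !)    ≤⟨ *-mono-≤ (s≤s (+-monoʳ-≤ t a≤b)) (!-exchange t a≤b) ⟩
  suc (t + b) * (a ! * (t + b) !)    ≡⟨ swap (suc (t + b)) (a !) _ ⟩
  a ! * (suc (t + b) * (t + b) !)    ∎
  where
  open ≤-Reasoning
  swap : ∀ x y z → x * (y * z) ≡ y * (x * z)
  swap = solve-∀

half+half : ∀ n → n / 2 ≤ n ∸ n / 2 × n ∸ n / 2 ≤ suc (n / 2)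
half+half n = m+n≤o⇒m≤o∸n (n / 2) (≤-trans (≤-reflexive (double (n / 2))) (m/n*n≤m n 2)) ,
  m≤n+o⇒m∸n≤o n (n / 2) (begin
    n                     ≡⟨ m≡m%n+[m/n]*n n 2 ⟩
    n % 2 + n / 2 * 2     ≤⟨ +-monoˡ-≤ _ (≤-pred (m%n<n n 2)) ⟩
    1 + n / 2 * 2         ≡⟨ odd (n / 2) ⟩
    n / 2 + suc (n / 2)   ∎)
  where
  open ≤-Reasoning
  double : ∀ h → h + h ≡ h * 2
  double = solve-∀
  odd : ∀ h → 1 + h * 2 ≡ h + (1 + h)
  odd = solve-∀

central-minimal : ∀ {n} a b → a + b ≡ n → (n / 2) ! * (n ∸ n / 2) ! ≤ a ! * b !
central-minimal {n} a b refl with a ≤? (a + b) / 2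
... | yes a≤p = begin
  p ! * q !             ≡⟨ cong (λ x → x ! * q !) (sym (m∸n+n≡m a≤p)) ⟩
  (t + a) ! * q !       ≤⟨ !-exchange t (≤-trans a≤p (proj₁ (half+half (a + b)))) ⟩
  a ! * (t + q) !       ≡⟨ cong (λ x → a ! * x !) t+q ⟩
  a ! * b !              ∎
  where
  open ≤-Reasoning
  p = (a + b) / 2
  q = a + b ∸ p
  t = p ∸ a
  t+q : t + q ≡ b
  t+q = +-cancelˡ-≡ a _ _ (trans (sym (+-assoc a t q)) (trans (cong (_+ q) (m+[n∸m]≡n a≤p)) (m+[n∸m]≡n (m/n≤m (a + b) 2))))
... | no  a≰p = begin
  p ! * q !             ≡⟨ *-comm (p !) _ ⟩
  q ! * p !             ≡⟨ cong (λ x → x ! * p !) (sym t+b) ⟩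
  (t + b) ! * p !        ≤⟨ !-exchange t b≤p ⟩
  b ! * (t + p) !        ≡⟨ cong (λ x → b ! * x !) (m∸n+n≡m p≤a) ⟩
  b ! * a !              ≡⟨ *-comm (b !) _ ⟩
  a ! * b !              ∎
  where
  open ≤-Reasoning
  p = (a + b) / 2
  q = a + b ∸ p
  p≤a : p ≤ a
  p≤a = ≰⇒≥ a≰p
  t = a ∸ p
  t+b : t + b ≡ q
  t+b = +-cancelˡ-≡ p _ _ (trans (sym (+-assoc p t b)) (trans (cong (_+ b) (m+[n∸m]≡n p≤a)) (sym (m+[n∸m]≡n (m/n≤m (a + b) 2)))))
  b≤p : b ≤ p
  -- For odd `n` the two halves differ by one, and `p < a` makes up for it.
  b≤p = +-cancelˡ-≤ (suc p) _ _ (begin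
    suc p + b      ≤⟨ +-monoˡ-≤ b (≰⇒> a≰p) ⟩
    a + b          ≡⟨ sym (m+[n∸m]≡n (m/n≤m (a + b) 2)) ⟩
    p + q         ≤⟨ +-monoʳ-≤ p (proj₂ (half+half (a + b))) ⟩
    p + suc p      ≡⟨ +-suc p p ⟩
    suc p + p      ∎)

central : ℕ → ℕ
central n = n C (n / 2)

n!≤central*chains : ∀ {n} (X : Subset n) → n ! ≤ central n * (∣ X ∣ ! * ∣ ∁ X ∣ !)
n!≤central*chains {n} X = ≤-trans (≤-reflexive (sym (nCk*k![n∸k]! (m/n≤m n 2))))
  (*-monoʳ-≤ (central n) (central-minimal ∣ X ∣ ∣ ∁ X ∣ (∣X∣+∣∁X∣ X)))

nCk≤central : ∀ n k → n C k ≤ central n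
nCk≤central n k with k ≤? n
... | no  k≰n = ≤-trans (≤-reflexive (k>n⇒nCk≡0 (≰⇒> k≰n))) z≤n
... | yes k≤n = *-cancelʳ-≤ (n C k) (central n) _ {{(n / 2) !* (n ∸ n / 2) !≢0}} (begin
  (n C k) * ((n / 2) ! * (n ∸ n / 2) !)      ≤⟨ *-monoʳ-≤ (n C k) (central-minimal k (n ∸ k) (m+[n∸m]≡n k≤n)) ⟩
  (n C k) * (k ! * (n ∸ k) !)                ≡⟨ nCk*k![n∸k]! k≤n ⟩
  n !                                      ≡⟨ sym (nCk*k![n∸k]! (m/n≤m n 2)) ⟩
  central n * ((n / 2) ! * (n ∸ n / 2) !)  ∎)
  where open ≤-Reasoning

ΣS-one : ∀ n → ΣS {n} (λ _ → 1) ≡ 2 ^ n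
ΣS-one zero    = refl
ΣS-one (suc n) = trans (cong₂ _+_ (ΣS-one n) (ΣS-one n)) (cong (2 ^ n +_) (sym (+-identityʳ _)))

sum-const : ∀ m c → sum {m} (λ _ → c) ≡ m * c
sum-const zero    c = refl
sum-const (suc m) c = cong (c +_) (sum-const m c)

2^n≤ : ∀ n → 2 ^ n ≤ suc n * central n
2^n≤ n = begin
  2 ^ n                                                          ≡⟨ sym (ΣS-one n) ⟩
  ΣS {n} (λ _ → 1)                                               ≤⟨ ΣS-mono in-some-level ⟩
  ΣS {n} (λ X → sum {suc n} (λ i → ind (∣ X ∣ ≡ᵇ toℕ i)))                    ≡⟨ sym (sum-ΣS {n} {suc n} (λ i X → ind (∣ X ∣ ≡ᵇ toℕ i))) ⟩
  sum {suc n} (λ i → ΣS {n} (λ X → ind (∣ X ∣ ≡ᵇ toℕ i)))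
    ≤⟨ sum-mono {suc n} (λ i → ≤-trans (≤-reflexive (level-size n (toℕ i))) (nCk≤central n (toℕ i))) ⟩
  sum {suc n} (λ _ → central n)                                  ≡⟨ sum-const (suc n) (central n) ⟩
  suc n * central n                                              ∎
  where
  open ≤-Reasoning
  in-some-level : ∀ X → 1 ≤ sum {suc n} (λ i → ind (∣ X ∣ ≡ᵇ toℕ i))
  in-some-level X = ≤-trans (≤-reflexive (cong ind (sym (trans (cong (∣ X ∣ ≡ᵇ_) (toℕ-fromℕ< ∣X∣<)) (≡ᵇ-refl ∣ X ∣)))))
    (sum-≥ {suc n} (λ i → ind (∣ X ∣ ≡ᵇ toℕ i)) (fromℕ< ∣X∣<))
    where
    ∣X∣< : ∣ X ∣ < suc n
    ∣X∣< = s≤s (≤-trans (m≤m+n _ _) (≤-reflexive (∣X∣+∣∁X∣ X)))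

-- Sets far from the middle level, by Chebyshev's inequality for the fourth moment

imbalance : Subset n → ℕ
imbalance X = ∣ ∣ X ∣ - ∣ ∁ X ∣ ∣

-- With `d = a - b` this expands `(d - 1) ^ 2 + (d + 1) ^ 2`: deciding about one more element is a
-- step of a symmetric walk. The sign of `d` is settled by cases.
square-step : ∀ a b → ∣ a - suc b ∣ ^ 2 + ∣ suc a - b ∣ ^ 2 ≡ 2 * ∣ a - b ∣ ^ 2 + 2
square-step zero    zero    = refl
square-step zero    (suc b) = lem b
  where
  lem : ∀ b → ((2 + b) * ((2 + b) * 1)) + (b * (b * 1)) ≡ 2 * ((1 + b) * ((1 + b) * 1)) + 2
  lem = solve-∀
square-step (suc a) zero    = trans (cong (λ d → d ^ 2 + (2 + a) ^ 2) (∣-∣-identityʳ a)) (lem a)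
  where
  lem : ∀ a → (a * (a * 1)) + ((2 + a) * ((2 + a) * 1)) ≡ 2 * ((1 + a) * ((1 + a) * 1)) + 2
  lem = solve-∀
square-step (suc a) (suc b) = square-step a b

fourth-step : ∀ a b → ∣ a - suc b ∣ ^ 4 + ∣ suc a - b ∣ ^ 4 ≡ 2 * ∣ a - b ∣ ^ 4 + (12 * ∣ a - b ∣ ^ 2 + 2)
fourth-step zero    zero    = refl
fourth-step zero    (suc b) = lem b
  where
  lem : ∀ b → ((2 + b) * ((2 + b) * ((2 + b) * ((2 + b) * 1)))) + (b * (b * (b * (b * 1)))) ≡ 2 * ((1 + b) * ((1 + b) * ((1 + b) * ((1 + b) * 1)))) + (12 * ((1 + b) * ((1 + b) * 1)) + 2)
  lem = solve-∀
fourth-step (suc a) zero    = trans (cong (λ d → d ^ 4 + (2 + a) ^ 4) (∣-∣-identityʳ a)) (lem a)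
  where
  lem : ∀ a → (a * (a * (a * (a * 1)))) + ((2 + a) * ((2 + a) * ((2 + a) * ((2 + a) * 1)))) ≡ 2 * ((1 + a) * ((1 + a) * ((1 + a) * ((1 + a) * 1)))) + (12 * ((1 + a) * ((1 + a) * 1)) + 2)
  lem = solve-∀
fourth-step (suc a) (suc b) = fourth-step a b

second-moment : ∀ n → ΣS {n} (λ X → imbalance X ^ 2) ≡ n * 2 ^ n
second-moment zero    = refl
second-moment (suc n) = begin
  ΣS {n} (λ X → ∣ ∣ X ∣ - suc ∣ ∁ X ∣ ∣ ^ 2) + ΣS {n} (λ X → ∣ suc ∣ X ∣ - ∣ ∁ X ∣ ∣ ^ 2)
    ≡⟨ sym (ΣS-+ {n} (λ X → ∣ ∣ X ∣ - suc ∣ ∁ X ∣ ∣ ^ 2) (λ X → ∣ suc ∣ X ∣ - ∣ ∁ X ∣ ∣ ^ 2)) ⟩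
  ΣS {n} (λ X → ∣ ∣ X ∣ - suc ∣ ∁ X ∣ ∣ ^ 2 + ∣ suc ∣ X ∣ - ∣ ∁ X ∣ ∣ ^ 2)
    ≡⟨ ΣS-cong {n} (λ X → square-step ∣ X ∣ ∣ ∁ X ∣) ⟩
  ΣS {n} (λ X → 2 * imbalance X ^ 2 + 2)
    ≡⟨ ΣS-+ (λ (X : Subset n) → 2 * imbalance X ^ 2) (λ _ → 2) ⟩
  ΣS {n} (λ X → 2 * imbalance X ^ 2) + ΣS {n} (λ _ → 2 * 1)
    ≡⟨ cong₂ _+_ (trans (ΣS-* 2 (λ (X : Subset n) → imbalance X ^ 2)) (cong (2 *_) (second-moment n)))
         (trans (ΣS-* 2 (λ (_ : Subset n) → 1)) (cong (2 *_) (ΣS-one n))) ⟩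
  2 * (n * 2 ^ n) + 2 * 2 ^ n
    ≡⟨ collect n (2 ^ n) ⟩
  suc n * (2 * 2 ^ n) ∎
  where
  open ≡-Reasoning
  collect : ∀ n p → 2 * (n * p) + 2 * p ≡ (1 + n) * (2 * p)
  collect = solve-∀

fourth-moment : ∀ n → ΣS {n} (λ X → imbalance X ^ 4) ≤ 3 * n ^ 2 * 2 ^ n
fourth-moment zero    = z≤n
fourth-moment (suc n) = begin
  ΣS {n} (λ X → ∣ ∣ X ∣ - suc ∣ ∁ X ∣ ∣ ^ 4) + ΣS {n} (λ X → ∣ suc ∣ X ∣ - ∣ ∁ X ∣ ∣ ^ 4)
    ≡⟨ sym (ΣS-+ {n} (λ X → ∣ ∣ X ∣ - suc ∣ ∁ X ∣ ∣ ^ 4) (λ X → ∣ suc ∣ X ∣ - ∣ ∁ X ∣ ∣ ^ 4)) ⟩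
  ΣS {n} (λ X → ∣ ∣ X ∣ - suc ∣ ∁ X ∣ ∣ ^ 4 + ∣ suc ∣ X ∣ - ∣ ∁ X ∣ ∣ ^ 4)
    ≡⟨ ΣS-cong {n} (λ X → fourth-step ∣ X ∣ ∣ ∁ X ∣) ⟩
  ΣS {n} (λ X → 2 * imbalance X ^ 4 + (12 * imbalance X ^ 2 + 2))
    ≡⟨ trans (ΣS-+ (λ (X : Subset n) → 2 * imbalance X ^ 4) (λ X → 12 * imbalance X ^ 2 + 2))
         (cong (ΣS {n} (λ X → 2 * imbalance X ^ 4) +_) (ΣS-+ (λ (X : Subset n) → 12 * imbalance X ^ 2) (λ _ → 2))) ⟩
  ΣS {n} (λ X → 2 * imbalance X ^ 4) + (ΣS {n} (λ X → 12 * imbalance X ^ 2) + ΣS {n} (λ _ → 2 * 1))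
    ≡⟨ cong₂ _+_ (ΣS-* 2 (λ (X : Subset n) → imbalance X ^ 4))
         (cong₂ _+_ (trans (ΣS-* 12 (λ (X : Subset n) → imbalance X ^ 2)) (cong (12 *_) (second-moment n)))
           (trans (ΣS-* 2 (λ (_ : Subset n) → 1)) (cong (2 *_) (ΣS-one n)))) ⟩
  2 * ΣS {n} (λ X → imbalance X ^ 4) + (12 * (n * 2 ^ n) + 2 * 2 ^ n)
    ≤⟨ +-monoˡ-≤ _ (*-monoʳ-≤ 2 (fourth-moment n)) ⟩
  2 * (3 * n ^ 2 * 2 ^ n) + (12 * (n * 2 ^ n) + 2 * 2 ^ n)
    -- The bound for `suc n` exceeds the recurrence by exactly `4 * 2 ^ n`.
    ≤⟨ m≤m+n _ (4 * 2 ^ n) ⟩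
  2 * (3 * n ^ 2 * 2 ^ n) + (12 * (n * 2 ^ n) + 2 * 2 ^ n) + 4 * 2 ^ n
    ≡⟨ collect n (2 ^ n) ⟩
  3 * suc n ^ 2 * (2 * 2 ^ n) ∎
  where
  open ≤-Reasoning
  collect : ∀ n p → 2 * (3 * (n * (n * 1)) * p) + (12 * (n * p) + 2 * p) + 4 * p ≡ 3 * ((1 + n) * ((1 + n) * 1)) * (2 * p)
  collect = solve-∀

far : ℕ → Family n
far {n} g X = n <ᵇ g * imbalance X

#_ : Family n → ℕ
# S = ΣS (λ X → ind (S X))

-- By Markov at most a `3 * g ^ 4 / n ^ 2` part of the power set is far. The crude `2^n≤` loses a
-- factor of order `n`, so the second moment, giving order `1 / n`, would be too weak.
far-few : ∀ n .{{_ : NonZero n}} g K → 6 * g ^ 4 * K ≤ n → K * # far {n} g ≤ central n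
far-few n g K enough = *-cancelˡ-≤ n (*-cancelˡ-≤ (n ^ 3) (begin
  n ^ 3 * (n * (K * # far {n} g))                ≡⟨ regroup n K (# far {n} g) ⟩
  K * (n ^ 4 * # far {n} g)                      ≡⟨ cong (K *_) (sym (ΣS-* (n ^ 4) (λ (X : Subset n) → ind (far g X)))) ⟩
  K * ΣS {n} (λ X → n ^ 4 * ind (far g X))       ≤⟨ *-monoʳ-≤ K (ΣS-mono markov) ⟩
  K * ΣS {n} (λ X → g ^ 4 * imbalance X ^ 4)     ≡⟨ cong (K *_) (ΣS-* (g ^ 4) (λ (X : Subset n) → imbalance X ^ 4)) ⟩
  K * (g ^ 4 * ΣS {n} (λ X → imbalance X ^ 4))   ≤⟨ *-monoʳ-≤ K (*-monoʳ-≤ (g ^ 4) (fourth-moment n)) ⟩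
  K * (g ^ 4 * (3 * n ^ 2 * 2 ^ n))              ≤⟨ *-monoʳ-≤ K (*-monoʳ-≤ (g ^ 4) (*-monoʳ-≤ (3 * n ^ 2)
                                                      (≤-trans (2^n≤ n) (*-monoˡ-≤ (central n) (+-monoˡ-≤ n (>-nonZero⁻¹ n)))))) ⟩
  K * (g ^ 4 * (3 * n ^ 2 * ((n + n) * central n))) ≡⟨ regroup′ n K (g ^ 4) (central n) ⟩
  n ^ 3 * (6 * g ^ 4 * K * central n)            ≤⟨ *-monoʳ-≤ (n ^ 3) (*-monoˡ-≤ (central n) enough) ⟩
  n ^ 3 * (n * central n)                        ∎))
  where
  open ≤-Reasoning
  instance
    n^3≢0 : NonZero (n ^ 3)
    n^3≢0 = m^n≢0 n 3
  regroup : ∀ n k f → (n * (n * (n * 1))) * (n * (k * f)) ≡ k * ((n * (n * (n * (n * 1)))) * f)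
  regroup = solve-∀
  regroup′ : ∀ n k g c → k * (g * (3 * (n * (n * 1)) * ((n + n) * c))) ≡ (n * (n * (n * 1))) * (6 * g * k * c)
  regroup′ = solve-∀
  ^-distrib : ∀ a b → ((a * b) * ((a * b) * ((a * b) * ((a * b) * 1)))) ≡ (a * (a * (a * (a * 1)))) * (b * (b * (b * (b * 1))))
  ^-distrib = solve-∀
  markov : ∀ (X : Subset n) → n ^ 4 * ind (far g X) ≤ g ^ 4 * imbalance X ^ 4
  markov X with far g X in eq
  ... | false = ≤-trans (≤-reflexive (*-zeroʳ (n ^ 4))) z≤n
  ... | true  = begin
    n ^ 4 * 1                      ≡⟨ *-identityʳ (n ^ 4) ⟩
    n ^ 4                          ≤⟨ ^-monoˡ-≤ 4 (<⇒≤ (<ᵇ⇒< n (g * imbalance X) (Equivalence.from Bool.T-≡ eq))) ⟩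
    (g * imbalance X) ^ 4          ≡⟨ ^-distrib g (imbalance X) ⟩
    g ^ 4 * imbalance X ^ 4        ∎

infix 4 _≟ˢ_
_≟ˢ_ : (X Y : Subset n) → Dec (X ≡ Y)
_≟ˢ_ = ≡-dec Bool._≟_

-- Exhaustive search through colourings and through tuples of sets.  Without function
-- extensionality the predicate has to respect pointwise equality.

Extensional : {A B : Set} → ((A → B) → Set) → Set
Extensional P = ∀ {f g} → (∀ x → f x ≡ g x) → P f → P g

anyColouring? : ∀ n {m} (P : (Subset n → Fin m) → Set) → Extensional P → (∀ f → Dec (P f)) → Dec (∃ P)
anyColouring? zero P ext P? = map′ (λ (y , p) → _ , p) (λ (f , p) → f [] , ext (λ { [] → refl }) p)
  (any? (λ y → P? (λ _ → y)))
anyColouring? (suc n) {m} P ext P? = map′ (λ (g , h , p) → _ , p)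
  (λ (f , p) → f ∘ (outside ∷_) , f ∘ (inside ∷_) , ext (λ { (outside ∷ X) → refl ; (inside ∷ X) → refl }) p)
  (anyColouring? n (λ g → ∃ λ h → P (glue g h))
    (λ g≗ (h , p) → h , ext (λ { (outside ∷ X) → g≗ X ; (inside ∷ X) → refl }) p)
    (λ g → anyColouring? n (λ h → P (glue g h))
      (λ h≗ → ext (λ { (outside ∷ X) → refl ; (inside ∷ X) → h≗ X })) (λ h → P? (glue g h))))
  where
  glue : (g reach : Subset n → Fin m) → Subset (suc n) → Fin m
  glue g h (outside ∷ X) = g X
  glue g h (inside  ∷ X) = h X

anyTuple? : ∀ k (P : (Fin k → Subset n) → Set) → Extensional P → (∀ f → Dec (P f)) → Dec (∃ P)
anyTuple? zero    P ext P? = map′ (λ p → _ , p) (λ (f , p) → ext (λ ()) p) (P? (λ ()))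
anyTuple? {n} (suc k) P ext P? = map′ (λ (X , f , p) → _ , p)
  (λ (f , p) → f zero , f ∘ suc , ext (λ { zero → refl ; (suc i) → refl }) p)
  (anySubset? (λ X → anyTuple? k (λ f → P (cons X f))
    (λ f≗ → ext (λ { zero → refl ; (suc i) → f≗ i })) (λ f → P? (cons X f))))
  where
  cons : Subset n → (Fin k → Subset n) → Fin (suc k) → Subset n
  cons X f zero    = X
  cons X f (suc i) = f i

all⊎? : ∀ {k} {P : Fin k ⊎ Fin k → Set} → (∀ x → Dec (P x)) → Dec (∀ x → P x)
all⊎? P? = map′ (λ { (f , g) (inj₁ i) → f i ; (f , g) (inj₂ i) → g i }) (λ h → h ∘ inj₁ , h ∘ inj₂)
  (all? (P? ∘ inj₁) ×-dec all? (P? ∘ inj₂))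

infix 4 _≟⊎_
_≟⊎_ : ∀ {k} (x y : Fin k ⊎ Fin k) → Dec (x ≡ y)
_≟⊎_ = Sum.≡-dec Fin._≟_ Fin._≟_

crownLe? : ∀ {k} x y → Dec (CrownLe k x y)
crownLe? (inj₁ i) (inj₁ j) = map′ (λ { refl → crown-refl _ }) (λ { (crown-refl _) → refl }) (i Fin.≟ j)
crownLe? (inj₂ i) (inj₂ j) = map′ (λ { refl → crown-refl _ }) (λ { (crown-refl _) → refl }) (i Fin.≟ j)
crownLe? (inj₂ i) (inj₁ j) = no λ ()
crownLe? {k} (inj₁ j) (inj₂ i) = map′
  (λ { (inj₁ refl) → crown-same _ ; (inj₂ (inj₁ e)) → crown-next _ _ e ; (inj₂ (inj₂ (e , z))) → crown-wrap _ _ e z })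
  (λ { (crown-same _) → inj₁ refl ; (crown-next _ _ e) → inj₂ (inj₁ e) ; (crown-wrap _ _ e z) → inj₂ (inj₂ (e , z)) })
  ((j Fin.≟ i) ⊎-dec (suc (toℕ i) ≟ toℕ j) ⊎-dec ((suc (toℕ i) ≟ k) ×-dec (toℕ j ≟ 0)))

RainbowCopy : ∀ (n m k : ℕ) → (Subset n → Fin m) → (Fin k ⊎ Fin k → Subset n) → Set
RainbowCopy n m k c f = IsStrongCopy n (CrownLe k) f × IsRainbow n m c f

rainbowCopy? : ∀ {n m k} c f → Dec (RainbowCopy n m k c f)
rainbowCopy? c f =
  (all⊎? (λ p → all⊎? (λ q → (f p ≟ˢ f q) →-dec (p ≟⊎ q)))
    ×-dec all⊎? (λ p → all⊎? (λ q → map′ (λ (to , from) → mk⇔ to from) (λ e → Equivalence.to e , Equivalence.from e)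
      ((crownLe? p q →-dec (f p ⊆? f q)) ×-dec ((f p ⊆? f q) →-dec crownLe? p q)))))
  ×-dec all⊎? (λ p → all⊎? (λ q → (c (f p) Fin.≟ c (f q)) →-dec (p ≟⊎ q)))

rainbowCopy-ext : ∀ {n m k} {c d : Subset n → Fin m} {f g : Fin k ⊎ Fin k → Subset n} →
                  (∀ X → c X ≡ d X) → (∀ p → f p ≡ g p) → RainbowCopy n m k c f → RainbowCopy n m k d g
rainbowCopy-ext {c = c} {d} {f} {g} c≗d f≗g ((inj , order) , rainbow) =
  ((λ p q e → inj p q (trans (f≗g p) (trans e (sym (f≗g q))))) ,
   (λ p q → subst₂ (λ X Y → CrownLe _ p q ⇔ X ⊆ Y) (f≗g p) (f≗g q) (order p q))) ,
  (λ p q e → rainbow p q (trans (same p) (trans e (sym (same q)))))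
  where
  same : ∀ p → c (f p) ≡ d (g p)
  same p = trans (c≗d (f p)) (cong d (f≗g p))

-- The lower and the upper elements of a copy are searched for as two tuples over `Fin k`.
noRainbowCopy? : ∀ {n m} k (c : Subset n → Fin m) → Dec (NoRainbowCopy n m (CrownLe k) c)
noRainbowCopy? {n} {m} k c = map′
  (λ none f copy rainbow → none (f ∘ inj₁ , f ∘ inj₂ ,
    ext {f} (λ { (inj₁ i) → refl ; (inj₂ i) → refl }) (copy , rainbow)))
  (λ { none (a , b , copy , rainbow) → none [ a , b ] copy rainbow })
  (¬? (anyTuple? k Q
    (λ { a≗ (b , p) → b , ext (λ { (inj₁ i) → a≗ i ; (inj₂ i) → refl }) p })
    (λ a → anyTuple? k (λ b → RainbowCopy n m k c [ a , b ])
      (λ b≗ → ext (λ { (inj₁ i) → refl ; (inj₂ i) → b≗ i }))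
      (λ b → rainbowCopy? c [ a , b ]))))
  where
  Q : (Fin k → Subset n) → Set
  Q a = ∃ λ b → RainbowCopy n m k c [ a , b ]
  ext : Extensional (RainbowCopy n m k c)
  ext = rainbowCopy-ext {c = c} (λ _ → refl)

Avoidable : (n k m : ℕ) → Set
Avoidable n k m = ∃ λ (c : Subset n → Fin m) → UsesExactly n m c × NoRainbowCopy n m (CrownLe k) c

avoidable? : ∀ n k m → Dec (Avoidable n k m)
avoidable? n k m = anyColouring? n
  (λ c → UsesExactly n m c × NoRainbowCopy n m (CrownLe k) c)
  (λ { {c} {d} c≗d (uses , none) →
    (λ y → let X , e = uses y in X , trans (sym (c≗d X)) e) ,
    (λ f copy rainbow → none f copy
      (proj₂ (rainbowCopy-ext {k = k} {c = d} {c} (sym ∘ c≗d) (λ _ → refl) (copy , rainbow)))) })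
  (λ c → all? (λ y → anySubset? (λ X → c X Fin.≟ y)) ×-dec noRainbowCopy? k c)

-- Search downwards from the bound `M`; at zero the known witness `m₀` is itself the maximum.
maximum : (P : ℕ → Set) → (∀ m → Dec (P m)) → ∀ {m₀} → P m₀ → ∀ M → (∀ m → P m → m ≤ M) →
          ∃ λ m → P m × (∀ m′ → P m′ → m′ ≤ m)
maximum P P? {m₀} p zero    bound = m₀ , p , λ m′ p′ → ≤-trans (bound m′ p′) z≤n
maximum P P? {m₀} p (suc M) bound with P? (suc M)
... | yes p′ = suc M , p′ , bound
... | no  ¬p = maximum P P? p M (λ m q → ≤-pred (≤∧≢⇒< (bound m q) (λ { refl → ¬p q })))

-- The lower bound

enum : (S : Family n) → Fin (# S) → Subset n
enum {zero}  S i = []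
enum {suc n} S i = [ (outside ∷_) ∘ enum (S ∘ (outside ∷_)) , (inside ∷_) ∘ enum (S ∘ (inside ∷_)) ]
                   (splitAt (# (S ∘ (outside ∷_))) i)

enum-∈ : (S : Family n) (i : Fin (# S)) → S (enum S i) ≡ true
enum-∈ {zero}  S i with S []
... | true = refl
enum-∈ {suc n} S i with splitAt (# (S ∘ (outside ∷_))) i
... | inj₁ j = enum-∈ (S ∘ (outside ∷_)) j
... | inj₂ j = enum-∈ (S ∘ (inside ∷_)) j

∷-injectiveʳ : ∀ {s t} {X Y : Subset n} → s ∷ X ≡ t ∷ Y → X ≡ Y
∷-injectiveʳ refl = refl

enum-injective : (S : Family n) (i j : Fin (# S)) → enum S i ≡ enum S j → i ≡ j
enum-injective {zero} S i j e with S []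
enum-injective {zero} S zero zero e | true = refl
enum-injective {suc n} S i j e
  with splitAt (# (S ∘ (outside ∷_))) i in eqᵢ | splitAt (# (S ∘ (outside ∷_))) j in eqⱼ
... | inj₁ x | inj₁ y = trans (sym (Fin.splitAt⁻¹-↑ˡ eqᵢ)) (trans
  (cong (_↑ˡ _) (enum-injective (S ∘ (outside ∷_)) x y (∷-injectiveʳ e))) (Fin.splitAt⁻¹-↑ˡ eqⱼ))
... | inj₂ x | inj₂ y = trans (sym (Fin.splitAt⁻¹-↑ʳ eqᵢ)) (trans
  (cong (# (S ∘ (outside ∷_)) ↑ʳ_) (enum-injective (S ∘ (inside ∷_)) x y (∷-injectiveʳ e))) (Fin.splitAt⁻¹-↑ʳ eqⱼ))

enum-surjective : (S : Family n) (X : Subset n) → S X ≡ true → ∃ λ i → enum S i ≡ X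
enum-surjective {zero}  S [] e rewrite e = zero , refl
enum-surjective {suc n} S (outside ∷ X) e =
  let i , eq = enum-surjective (S ∘ (outside ∷_)) X e
  in i ↑ˡ _ , trans (cong [ _ , _ ] (splitAt-↑ˡ (# (S ∘ (outside ∷_))) i _)) (cong (outside ∷_) eq)
enum-surjective {suc n} S (inside ∷ X) e =
  let i , eq = enum-surjective (S ∘ (inside ∷_)) X e
  in # (S ∘ (outside ∷_)) ↑ʳ i , trans (cong [ _ , _ ] (splitAt-↑ʳ (# (S ∘ (outside ∷_))) _ i)) (cong (inside ∷_) eq)

⊆-∣∣⇒≡ : {X Y : Subset n} → X ⊆ Y → ∣ X ∣ ≡ ∣ Y ∣ → X ≡ Y
⊆-∣∣⇒≡ {X = X} {Y} X⊆Y e with Y ⊆? X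
... | yes Y⊆X = ⊆-antisym X⊆Y Y⊆X
... | no  Y⊈X = let t , t∈Y , t∉X = ⊈-witness Y X Y⊈X in
  contradiction e (<⇒≢ (p⊂q⇒∣p∣<∣q∣ (X⊆Y , t , lookup⇒[]= t Y t∈Y ,
    λ t∈X → contradiction (trans (sym ([]=⇒lookup t∈X)) t∉X) λ ())))

middle-avoidable : ∀ n k → 2 ≤ n → Avoidable n (2 + k) (suc (central n))
middle-avoidable n k 2≤n = subst (λ m → Avoidable n (2 + k) (suc m)) (level-size n (n / 2)) (c , uses , none)
  where
  M : Family n
  M X = ∣ X ∣ ≡ᵇ n / 2

  level : ∀ X → M X ≡ true → ∣ X ∣ ≡ n / 2
  level X e = ≡ᵇ⇒≡ ∣ X ∣ (n / 2) (Equivalence.from Bool.T-≡ e)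

  index? : ∀ X → Dec (∃ λ i → enum M i ≡ X)
  index? X = any? (λ i → enum M i ≟ˢ X)

  c : Subset n → Fin (suc (# M))
  c X with index? X
  ... | yes (i , _) = suc i
  ... | no  _       = zero

  off-middle : ∀ X → c X ≢ zero → M X ≡ true
  off-middle X ne with index? X
  ... | yes (i , e) = subst (λ Y → M Y ≡ true) e (enum-∈ M i)
  ... | no  _       = contradiction refl ne

  uses : UsesExactly n _ c
  -- The empty set lies off the middle level, since `2 ≤ n` gives `n / 2 > 0`.
  uses zero = ⊥ , c⊥
    where
    c⊥ : c ⊥ ≡ zero
    c⊥ with index? ⊥
    ... | no  _       = refl
    ... | yes (i , e) = contradiction (trans (sym (∣⊥∣≡0 n)) (level ⊥ (subst (λ Y → M Y ≡ true) e (enum-∈ M i))))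
      (<⇒≢ (m≥n⇒m/n>0 2≤n))
  uses (suc i) = enum M i , c-enum
    where
    c-enum : c (enum M i) ≡ suc i
    c-enum with index? (enum M i)
    ... | yes (j , e) = cong suc (enum-injective M j i e)
    ... | no  ne      = contradiction (i , refl) ne

  none : NoRainbowCopy n _ (CrownLe (2 + k)) c
  none f (injective , order) rainbow with off zero | off (suc zero)
    where
    -- Two comparable sets on the same level would coincide, so each pair has a member of colour
    -- `zero`; two such pairs repeat that colour.
    off : ∀ i → c (f (inj₁ i)) ≡ zero ⊎ c (f (inj₂ i)) ≡ zero
    off i with c (f (inj₁ i)) Fin.≟ zero | c (f (inj₂ i)) Fin.≟ zero
    ... | yes e | _     = inj₁ e
    ... | no _  | yes e = inj₂ e
    ... | no e  | no e′ = contradiction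
      (injective _ _ (⊆-∣∣⇒≡ (Equivalence.to (order _ _) (crown-same i))
        (trans (level (f (inj₁ i)) (off-middle _ e)) (sym (level (f (inj₂ i)) (off-middle _ e′))))))
      λ ()
  ... | inj₁ e | inj₁ e′ = contradiction (rainbow _ _ (trans e (sym e′))) λ ()
  ... | inj₁ e | inj₂ e′ = contradiction (rainbow _ _ (trans e (sym e′))) λ ()
  ... | inj₂ e | inj₁ e′ = contradiction (rainbow _ _ (trans e (sym e′))) λ ()
  ... | inj₂ e | inj₂ e′ = contradiction (rainbow _ _ (trans e (sym e′))) λ ()

sum-zero : ∀ m → sum {m} (λ _ → 0) ≡ 0
sum-zero m = trans (sum-const m 0) (*-zeroʳ m)

sum-point : ∀ {m} b (x : Fin m) → sum (λ y → ind (b ∧ does (x Fin.≟ y))) ≡ ind b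
sum-point {m} false x = sum-zero m
sum-point {suc m} true  zero = cong suc (sum-zero m)
sum-point true  (suc x) = sum-point true x

-- One set of each colour, for the colours that do not occur among the far sets

module Transversal {n m : ℕ} (c : Subset n → Fin m) (uses : UsesExactly n m c) (g : ℕ) where

  rep : Fin m → Subset n
  rep y = proj₁ (uses y)

  farColour? : ∀ y → Dec (∃ λ G → far g G ≡ true × c G ≡ y)
  farColour? y = anySubset? (λ G → (far g G Bool.≟ true) ×-dec (c G Fin.≟ y))

  F : Family n
  F X = does (rep (c X) ≟ˢ X) ∧ not (does (farColour? (c X)))

  F-rep : ∀ X → F X ≡ true → rep (c X) ≡ X
  F-rep X e with rep (c X) ≟ˢ X
  ... | yes eq = eq

  F-far : ∀ X → F X ≡ true → ∀ G → far g G ≡ true → c X ≢ c G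
  F-far X e G G-far eq with farColour? (c X) | proj₂ (∧-true {does (rep (c X) ≟ˢ X)} e)
  ... | no none | _ = none (G , G-far , sym eq)

  -- A far `X` would be a far set of its own colour.
  F-near : ∀ X → F X ≡ true → g * imbalance X ≤ n
  F-near X e with far g X in eq
  ... | true  = contradiction refl (F-far X e X eq)
  ... | false = ≮⇒≥ (λ lt → contradiction (trans (sym (Equivalence.to Bool.T-≡ (<⇒<ᵇ lt))) eq) λ ())

  F-injective : ∀ X Y → F X ≡ true → F Y ≡ true → c X ≡ c Y → X ≡ Y
  F-injective X Y e e′ eq = trans (sym (F-rep X e)) (trans (cong rep eq) (F-rep Y e′))

  private
    at : Family n → Fin m → Subset n → ℕ
    at S y X = ind (S X ∧ does (c X Fin.≟ y))

    at-one : ∀ S y X → S X ≡ true → c X ≡ y → 1 ≤ ΣS (at S y)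
    at-one S y X e eq = ≤-trans (≤-reflexive (cong ind (sym (cong₂ _∧_ e (dec-true (c X Fin.≟ y) eq)))))
      (ΣS-≥ (at S y) X)

    at-sum : ∀ S → sum (λ y → ΣS (at S y)) ≡ # S
    at-sum S = trans (sum-ΣS (at S)) (ΣS-cong (λ X → sum-point (S X) (c X)))

  -- Each colour is borne by its representative in `F` or by some far set, and summing over the
  -- colours counts every set once.
  colours≤ : m ≤ # F + # far {n} g
  colours≤ = begin
    m                                                          ≡⟨ sym (trans (sum-const m 1) (*-identityʳ m)) ⟩
    sum {m} (λ _ → 1)                                          ≤⟨ sum-mono each ⟩
    sum (λ y → ΣS (at F y) + ΣS (at (far g) y))                ≡⟨ ∑-distrib-+ _ (λ y → ΣS (at (far g) y)) ⟩
    sum (λ y → ΣS (at F y)) + sum (λ y → ΣS (at (far g) y))    ≡⟨ cong₂ _+_ (at-sum F) (at-sum (far g)) ⟩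
    # F + # far {n} g                                          ∎
    where
    open ≤-Reasoning
    each : ∀ y → 1 ≤ ΣS (at F y) + ΣS (at (far g) y)
    each y with farColour? y
    ... | yes (G , G-far , eq) = ≤-trans (at-one (far g) y G G-far eq) (m≤n+m _ _)
    ... | no none = ≤-trans (at-one F y (rep y) rep∈F (proj₂ (uses y))) (m≤m+n _ _)
      where
      rep∈F : F (rep y) ≡ true
      rep∈F = cong₂ (λ a b → a ∧ not b)
        (dec-true (rep (c (rep y)) ≟ˢ rep y) (cong rep (proj₂ (uses y))))
        (dec-false (farColour? (c (rep y))) (subst (λ z → ¬ ∃ λ G → far g G ≡ true × c G ≡ z) (sym (proj₂ (uses y))) none))

-- From the size of the family to its mass

-- At least `n ! / central n` maximal chains pass through any set, the middle level having the
-- fewest.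
#*n!≤ : (F : Family n) → # F * n ! ≤ central n * mass F
#*n!≤ {n} F = begin
  # F * n !                                           ≡⟨ *-comm (# F) (n !) ⟩
  n ! * # F                                           ≡⟨ sym (ΣS-* (n !) (ind ∘ F)) ⟩
  ΣS (λ X → n ! * ind (F X))                          ≤⟨ ΣS-mono pointwise ⟩
  ΣS (λ X → central n * (charge F X * ∣ ∁ X ∣ !))     ≡⟨ ΣS-* (central n) (λ X → charge F X * ∣ ∁ X ∣ !) ⟩
  central n * mass F                                  ∎
  where
  open ≤-Reasoning
  pointwise : ∀ X → n ! * ind (F X) ≤ central n * (charge F X * ∣ ∁ X ∣ !)
  pointwise X with F X
  ... | true  = ≤-trans (≤-reflexive (*-identityʳ (n !))) (n!≤central*chains X)
  ... | false = ≤-trans (≤-reflexive (*-zeroʳ (n !))) z≤n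

central>0 : ∀ n → 0 < central n
central>0 n with central n | nCk*k![n∸k]! (m/n≤m n 2)
... | zero  | e = contradiction (sym e) (≢-nonZero⁻¹ (n !) {{n !≢0}})
... | suc _ | _ = z<s

-- With 8 H ≤ g and L = n / g, the levels met by sets outside far g differ by at most L, and H L
-- is small against n.

near-levels : ∀ a b a′ b′ L → a + b ≡ a′ + b′ → ∣ a - b ∣ ≤ L → ∣ a′ - b′ ∣ ≤ L → b ≤ b′ + L
near-levels a b a′ b′ L e d d′ = *-cancelˡ-≤ 2 (+-cancelˡ-≤ (a + b) _ _ (begin
  (a + b) + 2 * b            ≤⟨ +-monoʳ-≤ (a + b) (+-monoʳ-≤ b (+-monoˡ-≤ 0 (≤-trans (m≤n+∣n-m∣ b a) (+-monoʳ-≤ a d)))) ⟩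
  (a + b) + (b + (a + L + 0)) ≡⟨ r₁ a b L ⟩
  (a + b) + (a + b) + L       ≡⟨ cong (λ s → (a + b) + s + L) e ⟩
  (a + b) + (a′ + b′) + L     ≤⟨ +-monoˡ-≤ L (+-monoʳ-≤ (a + b) (+-monoˡ-≤ b′ (≤-trans (m≤n+∣m-n∣ a′ b′) (+-monoʳ-≤ b′ d′)))) ⟩
  (a + b) + (b′ + L + b′) + L ≡⟨ r₂ (a + b) b′ L ⟩
  (a + b) + 2 * (b′ + L)      ∎))
  where
  open ≤-Reasoning
  r₁ : ∀ a b L → (a + b) + (b + (a + L + 0)) ≡ (a + b) + (a + b) + L
  r₁ = solve-∀
  r₂ : ∀ s b L → s + (b + L + b) + L ≡ s + 2 * (b + L)
  r₂ = solve-∀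

half-level : ∀ a b L → ∣ a - b ∣ ≤ L → 2 * L ≤ a + b → a + b ≤ 4 * b
half-level a b L d 2L≤ = +-cancelˡ-≤ (a + b) _ _ (begin
  (a + b) + (a + b)          ≡⟨ r₁ a b ⟩
  2 * a + 2 * b              ≤⟨ +-monoˡ-≤ (2 * b) (*-monoʳ-≤ 2 (≤-trans (m≤n+∣m-n∣ a b) (+-monoʳ-≤ b d))) ⟩
  2 * (b + L) + 2 * b        ≡⟨ r₂ b L ⟩
  2 * L + 4 * b              ≤⟨ +-monoˡ-≤ (4 * b) 2L≤ ⟩
  (a + b) + 4 * b            ∎)
  where
  open ≤-Reasoning
  r₁ : ∀ a b → (a + b) + (a + b) ≡ 2 * a + 2 * b
  r₁ = solve-∀
  r₂ : ∀ b L → 2 * (b + L) + 2 * b ≡ 2 * L + 4 * b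
  r₂ = solve-∀

halve-< : ∀ x y → 2 * x ≤ y → 3 ≤ y → suc x < y
halve-< zero          y le 3≤y = ≤-trans (n≤1+n 2) 3≤y
halve-< (suc zero)    y le 3≤y = 3≤y
halve-< (suc (suc x)) y le 3≤y = ≤-trans (s≤s (s≤s (≤-trans (≤-reflexive (+-comm 2 x))
  (+-monoʳ-≤ x (s≤s (s≤s z≤n)))))) (≤-trans (≤-reflexive (cong (λ z → suc (suc (x + z))) (sym (+-identityʳ _)))) le)

module Dense (E r H g : ℕ) .{{_ : NonZero g}} (8H≤g : 8 * H ≤ g)
  (≤H₀ : 4 * suc E ≤ H) (≤H₁ : 4 * suc E * suc r ≤ H)
  (≤H₂ : threshold E * suc (2 * suc r) * suc (suc r) ≤ H)
  {n : ℕ} (9≤n : 9 ≤ n) (F : Family n) (F-near : ∀ X → F X ≡ true → g * imbalance X ≤ n)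
  (dense : suc E * central n ≤ E * # F)
  where

  private
    L : ℕ
    L = n / g

    gL≤n : g * L ≤ n
    gL≤n = ≤-trans (≤-reflexive (*-comm g L)) (m/n*n≤m n g)

    n>0 : 0 < n
    n>0 = ≤-trans (s≤s z≤n) 9≤n

    imbalance≤L : ∀ X → F X ≡ true → imbalance X ≤ L
    imbalance≤L X X∈ = ≤-trans (≤-reflexive (sym (m*n/n≡m (imbalance X) g)))
      (/-monoˡ-≤ g (≤-trans (≤-reflexive (*-comm (imbalance X) g)) (F-near X X∈)))

    imbalanceᵈ≤L : ∀ X → F X ≡ true → ∣ ∣ ∁ X ∣ - ∣ X ∣ ∣ ≤ L
    imbalanceᵈ≤L X X∈ = ≤-trans (≤-reflexive (∣-∣-comm ∣ ∁ X ∣ ∣ X ∣)) (imbalance≤L X X∈)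

    size : ∀ X → ∣ X ∣ + ∣ ∁ X ∣ ≡ n
    size = ∣X∣+∣∁X∣

    sizeᵈ : ∀ X → ∣ ∁ X ∣ + ∣ X ∣ ≡ n
    sizeᵈ X = trans (+-comm ∣ ∁ X ∣ _) (size X)

    near : ∀ X Y → F X ≡ true → F Y ≡ true → ∣ ∁ X ∣ ≤ ∣ ∁ Y ∣ + L
    near X Y X∈ Y∈ = near-levels (∣ X ∣) _ (∣ Y ∣) _ L (trans (size X) (sym (size Y))) (imbalance≤L X X∈) (imbalance≤L Y Y∈)

    nearᵈ : ∀ X Y → F X ≡ true → F Y ≡ true → ∣ X ∣ ≤ ∣ Y ∣ + L
    nearᵈ X Y X∈ Y∈ = near-levels (∣ ∁ X ∣) _ (∣ ∁ Y ∣) _ L (trans (sizeᵈ X) (sym (sizeᵈ Y))) (imbalanceᵈ≤L X X∈) (imbalanceᵈ≤L Y Y∈)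

    8≤g : 8 ≤ g
    8≤g = ≤-trans (*-monoʳ-≤ 8 (≤-trans (s≤s z≤n) ≤H₀)) 8H≤g

    2L≤n : 2 * L ≤ n
    2L≤n = ≤-trans (*-monoˡ-≤ L (≤-trans (m≤m+n 2 6) 8≤g)) gL≤n

    centre : ∀ X → F X ≡ true → n ≤ 4 * ∣ ∁ X ∣
    centre X X∈ = ≤-trans (≤-reflexive (sym (size X))) (half-level (∣ X ∣) _ L (imbalance≤L X X∈)
      (≤-trans 2L≤n (≤-reflexive (sym (size X)))))

    centreᵈ : ∀ X → F X ≡ true → n ≤ 4 * ∣ X ∣
    centreᵈ X X∈ = ≤-trans (≤-reflexive (sym (sizeᵈ X))) (half-level (∣ ∁ X ∣) _ L (imbalanceᵈ≤L X X∈)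
      (≤-trans 2L≤n (≤-reflexive (sym (sizeᵈ X)))))

    -- From `8 * h * L ≤ n ≤ 4 * d` follows `2 * (h * L) ≤ d`, and `9 ≤ n` gives `3 ≤ d`, which
    -- leaves space for the extra `suc`.
    room : ∀ {d} → n ≤ 4 * d → ∀ h → h ≤ H → suc (h * L) < d
    room {d} n≤ h h≤ = halve-< (h * L) d (*-cancelˡ-≤ 4 (begin
      4 * (2 * (h * L))   ≡⟨ regroup h L ⟩
      8 * h * L           ≤⟨ *-monoˡ-≤ L (≤-trans (*-monoʳ-≤ 8 h≤) 8H≤g) ⟩
      g * L               ≤⟨ gL≤n ⟩
      n                   ≤⟨ n≤ ⟩
      4 * d               ∎)) (*-cancelˡ-< 4 2 d (≤-trans 9≤n n≤))
      where
      open ≤-Reasoning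
      regroup : ∀ h L → 4 * (2 * (h * L)) ≡ 8 * h * L
      regroup = solve-∀

    room′ : ∀ {d} → n ≤ 4 * d → ∀ a b → a * b ≤ H → suc (a * (b * L)) < d
    room′ {d} n≤ a b h≤ = subst (λ x → suc x < d) (*-assoc a b L) (room n≤ (a * b) h≤)

    not-full : ∀ X → F X ≡ true → ∣ ∁ X ∣ ≢ 0
    not-full X X∈ e = <⇒≱ (room (centre X X∈) 0 z≤n) (≤-trans (≤-reflexive e) z≤n)

    -- A random maximal chain meets `F` at least `1 + 1 / E` times on average.
    rich : suc E * n ! ≤ E * mass F
    rich = *-cancelˡ-≤ (central n) {{>-nonZero (central>0 n)}} (begin
      central n * (suc E * n !)       ≡⟨ swap (central n) (suc E) (n !) ⟩
      suc E * central n * n !         ≤⟨ *-monoˡ-≤ (n !) dense ⟩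
      E * # F * n !                   ≡⟨ *-assoc E (# F) (n !) ⟩
      E * (# F * n !)                 ≤⟨ *-monoʳ-≤ E (#*n!≤ F) ⟩
      E * (central n * mass F)        ≡⟨ swap′ E (central n) (mass F) ⟩
      central n * (E * mass F)        ∎)
      where
      open ≤-Reasoning
      swap : ∀ a b c → a * (b * c) ≡ b * a * c
      swap = solve-∀
      swap′ : ∀ a b c → a * (b * c) ≡ b * (a * c)
      swap′ = solve-∀

    mass>0 : 0 < mass F
    mass>0 = *-cancelˡ-< E 0 (mass F) (begin-strict
      E * 0              ≡⟨ *-zeroʳ E ⟩
      0                  <⟨ 1≤n! n ⟩
      n !                ≤⟨ m≤m+n (n !) (E * n !) ⟩
      suc E * n !        ≤⟨ rich ⟩
      E * mass F         ∎)
      where open ≤-Reasoning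

    -- By `rich` the term `n !` in `mass-≤-μ` is at most an `E / suc E` part of the mass.
    large : mass F ≤ suc E * μ (withTop F) F F
    large = +-cancelʳ-≤ (E * mass F) _ _ (begin
      suc E * mass F                             ≤⟨ *-monoʳ-≤ (suc E) (mass-≤-μ F not-full) ⟩
      suc E * (μ (withTop F) F F + n !)          ≡⟨ *-distribˡ-+ (suc E) _ (n !) ⟩
      suc E * μ (withTop F) F F + suc E * n !    ≤⟨ +-monoʳ-≤ _ rich ⟩
      suc E * μ (withTop F) F F + E * mass F     ∎)
      where open ≤-Reasoning

    open Extremal F L near nearᵈ E large n>0 centre
      (λ X X∈ → <⇒≤ (<-trans (n<1+n _) (room (centre X X∈) (4 * suc E) ≤H₀)))

  closed-walk : ∃ λ v → ∃ λ A → ∃ λ B → A ⊆ B × F B ≡ true × lookup B v ≡ inside × Walk F v (suc r) A B [] []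
  closed-walk =
    let v , m≤ = choose
    -- A crown with `3 + r` lower elements takes `suc r` rounds, hence the constants at `suc r`.
    in v , Walks.closed-walk (suc r) v
         (λ X X∈ → <-trans (n<1+n _) (room′ (centre X X∈) (c₀ * suc (2 * suc r)) (suc (suc r)) ≤H₂))
         (λ X X∈ → <-trans (n<1+n _) (room′ (centreᵈ X X∈) (c₀ * suc (2 * suc r)) (suc (suc r)) ≤H₂))
         (λ X X∈ → suc[m]≤n⇒m≤pred[n] (room′ {∣ ∁ X ∣} (centre X X∈) (4 * suc E) (suc r) ≤H₁))
         mass>0 m≤

-- The upper bound

-- By `F-far`, no member of the transversal then shares the colour of `⁅ v ⁆`.
singleton-far : ∀ {n g} → 8 ≤ g → 9 ≤ n → (v : Fin n) → far g ⁅ v ⁆ ≡ true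
singleton-far {n} {g} 8≤g 9≤n v = Equivalence.to Bool.T-≡ (<⇒<ᵇ (begin-strict
  n                                    <⟨ wide n 9≤n ⟩
  8 * (n ∸ 2)                          ≤⟨ *-monoˡ-≤ (n ∸ 2) 8≤g ⟩
  g * (n ∸ 2)                          ≡⟨ cong (g *_) (sym (imbalanced (∣⁅x⁆∣≡1 v) (∣X∣+∣∁X∣ ⁅ v ⁆))) ⟩
  g * imbalance ⁅ v ⁆                  ∎))
  where
  open ≤-Reasoning
  imbalanced : ∀ {a b} → a ≡ 1 → a + b ≡ n → ∣ a - b ∣ ≡ n ∸ 2
  imbalanced {b = zero}  refl refl = contradiction 9≤n λ { (s≤s ()) }
  imbalanced {b = suc b} refl refl = refl
  wide : ∀ n → 9 ≤ n → n < 8 * (n ∸ 2)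
  wide (suc (suc n)) (s≤s (s≤s 7≤n)) = begin-strict
    2 + n              <⟨ +-monoˡ-< n (s≤s (s≤s (s≤s z≤n))) ⟩
    7 + n              ≤⟨ +-monoˡ-≤ n (≤-trans 7≤n (m≤m+n n _)) ⟩
    7 * n + n          ≡⟨ +-comm (7 * n) n ⟩
    8 * n              ∎

-- The colours exceed the middle level by a `1 / suc e` part of its size. The far sets take at most
-- half of this excess, which leaves density `1 + 1 / E` with `E = 2 + 2 * e`.
dense-transversal : ∀ {n m} .{{_ : NonZero n}} g e (c : Subset n → Fin m) (uses : UsesExactly n m c) →
                    6 * g ^ 4 * (2 * suc e) ≤ n → suc (suc e) * central n ≤ suc e * m →
                    let open Transversal c uses g in (3 + 2 * e) * central n ≤ (2 + 2 * e) * # F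
dense-transversal {n} {m} g e c uses enough many = +-cancelʳ-≤ (central n) _ _ (begin
  (3 + 2 * e) * central n + central n        ≡⟨ r₁ e (central n) ⟩
  2 * (suc (suc e) * central n)              ≤⟨ *-monoʳ-≤ 2 {suc (suc e) * central n} {suc e * (# F + # far {n} g)}
                                                  (≤-trans many (*-monoʳ-≤ (suc e) colours≤)) ⟩
  2 * (suc e * (# F + # far {n} g))          ≡⟨ r₂ e (# F) (# far {n} g) ⟩
  (2 + 2 * e) * # F + 2 * suc e * # far {n} g
    ≤⟨ +-monoʳ-≤ ((2 + 2 * e) * # F) (far-few n g (2 * suc e) enough) ⟩
  (2 + 2 * e) * # F + central n              ∎)
  where
  open ≤-Reasoning
  open Transversal c uses g
  r₁ : ∀ e c → (3 + 2 * e) * c + c ≡ 2 * ((2 + e) * c)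
  r₁ = solve-∀
  r₂ : ∀ e f k → 2 * ((1 + e) * (f + k)) ≡ (2 + 2 * e) * f + 2 * (1 + e) * k
  r₂ = solve-∀

abstract
  constants : ∀ e r → ∃ λ E → E ≡ 2 + 2 * e × ∃ λ H → ∃ λ g → NonZero g × 8 * H ≤ g × 4 * suc E ≤ H ×
              4 * suc E * suc r ≤ H × threshold E * suc (2 * suc r) * suc (suc r) ≤ H
  constants e r = E , refl , H , 8 * H , >-nonZero (≤-trans (s≤s z≤n) (*-monoʳ-≤ 8 (≤-trans (s≤s z≤n) H₀≤))) , ≤-refl , H₀≤ ,
    ≤-trans (m≤m+n H₁ H₂) (m≤n+m _ H₀) , ≤-trans (m≤n+m H₂ H₁) (m≤n+m _ H₀)
    where
    E H₀ H₁ H₂ H : ℕ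
    E = 2 + 2 * e
    H₀ = 4 * suc E
    H₁ = 4 * suc E * suc r
    H₂ = threshold E * suc (2 * suc r) * suc (suc r)
    H = H₀ + (H₁ + H₂)
    H₀≤ : H₀ ≤ H
    H₀≤ = m≤m+n H₀ _

upper-bound : ∀ e r → ∃ λ N → 2 ≤ N × (∀ n m → N ≤ n → Avoidable n (3 + r) m → suc e * m ≤ suc (suc e) * central n)
upper-bound e r with constants e r
-- The summand `9` serves the small inequalities on `n`, the other one `far-few` with
-- `K = 2 * suc e`.
... | E , E≡ , H , g , g≢0 , 8H≤g , ≤H₀ , ≤H₁ , ≤H₂ = 9 + 6 * g ^ 4 * (2 * suc e) , s≤s (s≤s z≤n) , bound
  where
  8≤g : 8 ≤ g
  8≤g = ≤-trans (*-monoʳ-≤ 8 (≤-trans (s≤s z≤n) ≤H₀)) 8H≤g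
  bound : ∀ n m → 9 + 6 * g ^ 4 * (2 * suc e) ≤ n → Avoidable n (3 + r) m → suc e * m ≤ suc (suc e) * central n
  bound n m N≤n (c , uses , none) = ≮⇒≥ λ many →
    let v , A , B , A⊆B , B∈F , v∈B , W = Dense.closed-walk E r H g {{g≢0}} 8H≤g ≤H₀ ≤H₁ ≤H₂ 9≤n F F-near
          (subst (λ E → suc E * central n ≤ E * # F) (sym E≡)
            (dense-transversal {{>-nonZero (≤-trans (s≤s z≤n) 9≤n)}} g e c uses (≤-trans (m≤n+m _ 9) N≤n) (<⇒≤ many)))
    in ClosedWalk.rainbow-crown F v r A B A⊆B B∈F v∈B W c F-injective
         (λ X X∈ → F-far X X∈ ⁅ v ⁆ (singleton-far 8≤g 9≤n v)) none
    where
    open Transversal c uses g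
    9≤n : 9 ≤ n
    9≤n = ≤-trans (m≤m+n 9 _) N≤n

-- Existence of the maximum and its asymptotics

theorem1p6 : ∀ (k : ℕ) → 3 ≤ k → ∀ (e : ℕ) → ∃ λ (N : ℕ) → ∀ (n : ℕ) → N ≤ n →
    ∃ λ (m : ℕ) → IsArStar n (CrownLe k) m
    × suc e * ∣ m - n C (n / 2) ∣ ≤ n C (n / 2)
theorem1p6 (suc (suc (suc r))) (s≤s (s≤s (s≤s z≤n))) e with upper-bound e r
... | N , 2≤N , upper = N , result
  where
  result : ∀ n → N ≤ n → ∃ λ m → IsArStar n (CrownLe (3 + r)) m × suc e * ∣ m - n C (n / 2) ∣ ≤ n C (n / 2)
  result n N≤n = m , (avoidable , λ m′ c uses none → maximal m′ (c , uses , none)) , (begin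
    -- The lower bound `M ≤ m` resolves the absolute value, and the upper bound does the rest.
    suc e * ∣ m - M ∣            ≡⟨ cong (suc e *_) (trans (∣-∣-comm m M) (m≤n⇒∣m-n∣≡n∸m M≤m)) ⟩
    suc e * (m ∸ M)              ≡⟨ *-distribˡ-∸ (suc e) m M ⟩
    suc e * m ∸ suc e * M        ≤⟨ ∸-monoˡ-≤ (suc e * M) (upper n m N≤n avoidable) ⟩
    M + suc e * M ∸ suc e * M    ≡⟨ m+n∸n≡m M (suc e * M) ⟩
    M                            ∎)
    where
    open ≤-Reasoning
    M = central n
    middle : Avoidable n (3 + r) (suc M)
    middle = middle-avoidable n (suc r) (≤-trans 2≤N N≤n)
    maximal-colouring = maximum (Avoidable n (3 + r)) (avoidable? n (3 + r)) middle (suc (suc e) * M)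
      -- The bound on `suc e * m` bounds `m` as well and limits the search.
      (λ m avoidable → ≤-trans (m≤m+n m _) (upper n m N≤n avoidable))
    m = proj₁ maximal-colouring
    avoidable = proj₁ (proj₂ maximal-colouring)
    maximal = proj₂ (proj₂ maximal-colouring)
    M≤m : M ≤ m
    M≤m = ≤-trans (n≤1+n M) (maximal (suc M) middle)
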